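{- $\mathrm{Space}(\mathrm{FPHP}_n^{n+1})=\Omega(n)$, where $\mathrm{Space}$ denotes $\mathrm{Res}(\oplus)$ space.
   Context: $\mathrm{FPHP}_n^{n+1}$ is the CNF in the variables $p_{ij}$, $i\in[n+1]$, $j\in[n]$, consisting of: pigeon axioms $\bigvee_{j\in[n]}p_{ij}$ for every $i\in[n+1]$; hole axioms $\neg p_{ij}\lor\neg p_{i'j}$ for all $i\ne i'\in[n+1]$ and $j\in[n]$; functionality axioms $\neg p_{ij}\lor\neg p_{ij'}$ for all $i\in[n+1]$ and $j\ne j'\in[n]$. It is viewed as a linear CNF by writing $x$ as $(x=1)$, $\neg x$ as $(x=0)$. $\mathrm{Res}(\oplus)$: linear clauses are disjunctions of equations $f=\alpha$ ($f$ a linear form over $\mathbb{F}_2$, $\alpha\in\{0,1\}$); rules: from $A\lor(f=0)$ and $B\lor(f=1)$ derive $A\lor B$, and from $C$ derive any linear clause semantically implied by $C$. A refutation is a sequence of configurations (sets of linear clauses) $S_1=\emptyset,\dots,S_m$ with $S_m$ containing the empty clause, each obtained from the previous by adding a formula clause, erasing a clause, or adding a clause derived by the rules from current clauses; space is $\max_i|S_i|$, and $\mathrm{Space}$ of a formula is the minimum over its refutations. -}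

module Defs where

open import Data.Nat using (ℕ; suc; _≤_; _*_)
open import Data.Product using (Σ; _×_)
open import Data.Bool using (Bool; true; false; _xor_; _∧_)
open import Data.Fin using (Fin; combine; _≟_)
open import Data.Vec using (Vec; foldr′; zipWith; tabulate)
open import Data.List using (List; []; _∷_; _++_; map; allFin; length; removeAt)
open import Data.List.Relation.Unary.Any using (Any)
open import Data.List.Membership.Propositional using (_∈_)
open import Data.List.Relation.Binary.Permutation.Propositional using (_↭_)
open import Relation.Binary.PropositionalEquality using (_≡_; _≢_)
open import Relation.Nullary.Decidable using (⌊_⌋)

-- A linear form over 𝔽₂ is its coefficient vector.
LinForm : ℕ → Set
LinForm m = Vec Bool m

Assignment : ℕ → Set
Assignment m = Vec Bool m

evalForm : ∀ {m} → LinForm m → Assignment m → Bool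
evalForm f ρ = foldr′ _xor_ false (zipWith _∧_ f ρ)

record LinEq (m : ℕ) : Set where
  constructor _==_
  field
    form : LinForm m
    rhs  : Bool
open LinEq public

LinClause : ℕ → Set
LinClause m = List (LinEq m)

Sat : ∀ {m} → Assignment m → LinClause m → Set
Sat ρ C = Any (λ e → evalForm (form e) ρ ≡ rhs e) C

_⊨_ : ∀ {m} → LinClause m → LinClause m → Set
_⊨_ {m} C D = (ρ : Assignment m) → Sat ρ C → Sat ρ D

Config : ℕ → Set
Config m = List (LinClause m)

data Step {m : ℕ} (Ax : LinClause m → Set) (S : Config m) : Config m → Set where
  axiom   : (C : LinClause m) → Ax C → Step Ax S (C ∷ S)
  erase   : (i : Fin (length S)) → Step Ax S (removeAt S i)
  resolve : (C₁ C₂ : LinClause m) (f : LinForm m) (A B : LinClause m) →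
            C₁ ∈ S → C₂ ∈ S →
            C₁ ↭ ((f == false) ∷ A) → C₂ ↭ ((f == true) ∷ B) →
            Step Ax S ((A ++ B) ∷ S)
  weaken  : (C D : LinClause m) → C ∈ S → C ⊨ D → Step Ax S (D ∷ S)

data Reach {m : ℕ} (Ax : LinClause m → Set) (s : ℕ) : Config m → Set where
  start : Reach Ax s []
  step  : ∀ {S S′} → Reach Ax s S → Step Ax S S′ → length S′ ≤ s → Reach Ax s S′

RefutableInSpace : ∀ {m} → (LinClause m → Set) → ℕ → Set
RefutableInSpace {m} Ax s = Σ (Config m) (λ S → Reach Ax s S × [] ∈ S)

NVars : ℕ → Set
NVars n = Fin (suc n * n)

p : ∀ {n} → Fin (suc n) → Fin n → LinForm (suc n * n)
p i j = tabulate (λ k → ⌊ combine i j ≟ k ⌋)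

pigeonClause : ∀ {n} → Fin (suc n) → LinClause (suc n * n)
pigeonClause {n} i = map (λ j → p i j == true) (allFin n)

data FPHP (n : ℕ) : LinClause (suc n * n) → Set where
  pigeon : (i : Fin (suc n)) → FPHP n (pigeonClause i)
  hole   : (i i′ : Fin (suc n)) (j : Fin n) → i ≢ i′ →
           FPHP n ((p i j == false) ∷ (p i′ j == false) ∷ [])
  func   : (i : Fin (suc n)) (j j′ : Fin n) → j ≢ j′ →
           FPHP n ((p i j == false) ∷ (p i j′ == false) ∷ [])

module Submission where

open import Defs
open import Data.Nat using (ℕ; _≤_; _*_)
open import Data.Product using (∃-syntax)
open import Data.Bool using (Bool; true; false; _xor_; _∧_; not; if_then_else_)
open import Data.Bool.Properties using (xor-same; xor-identityʳ; xor-comm; xor-assoc; ∧-zeroʳ; ∧-comm; ∧-assoc) renaming (_≟_ to _≟ᵇ_)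
open import Data.Bool.Solver using (module xor-∧-Solver)
open import Data.Empty using (⊥-elim) renaming (⊥ to Empty)
open import Data.Fin using (Fin; zero; suc; _≟_; combine; remQuot)
open import Data.Fin.Properties using (any?; pigeonhole; suc-injective; <⇒≢; remQuot-combine)
open import Data.Fin.Subset using (Subset; _∩_; _∪_; _-_; _─_; ∣_∣; ⊤; ⊥; ⁅_⁆) renaming (_∈_ to _∈ₛ_; _∉_ to _∉ₛ_; _⊆_ to _⊆ₛ_)
open import Data.Fin.Subset.Properties using (⊆-antisym; p⊆q⇒∣p∣≤∣q∣; p⊂q⇒∣p∣<∣q∣; x∈p⇒∣p-x∣<∣p∣; x∈p∧x≢y⇒x∈p-y; p─q⊆p; ∣p─q∣≤∣p∣; x∈p∧x∉q⇒x∈p─q; p∩q⊆p; p∩q⊆q; x∈p∩q⁺; ∣p∩q∣≤∣p∣; p⊆p∪q; q⊆p∪q; ∣⊥∣≡0; ∣⁅x⁆∣≡1; ⊆⊤; x∈⁅x⁆) renaming (_∈?_ to _∈ₛ?_)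
open import Data.List using (List; []; _∷_; _++_; length; map; removeAt)
open import Data.List.Membership.DecPropositional using () renaming (_∈?_ to mem?)
open import Data.List.Membership.Propositional using (_∈_; _∉_; find; lose)
open import Data.List.Membership.Propositional.Properties using (∈-∃++; ∈-++⁺ˡ; ∈-++⁺ʳ; ∈-map⁺; ∈-map⁻; ∈-allFin)
import Data.List.Membership.Setoid.Properties as Membershipₛ
open import Data.List.Properties using (length-map)
open import Data.List.Relation.Binary.Permutation.Propositional using (_↭_; refl; prep; swap; trans; ↭-sym; ↭⇒↭ₛ)
open import Data.List.Relation.Binary.Permutation.Propositional.Properties using (shift; ∈-resp-↭; ↭-length; ++-comm)
import Data.List.Relation.Binary.Permutation.Setoid.Properties as Permutationₛ
open import Data.List.Relation.Binary.Pointwise using (Pointwise; []; _∷_; Pointwise-length)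
open import Data.List.Relation.Unary.All.Properties using (¬Any⇒All¬; All¬⇒¬Any)
open import Data.List.Relation.Unary.AllPairs as AllPairs using ([]; _∷_)
open import Data.List.Relation.Unary.Any using (here; there; index) renaming (any? to anyL?)
open import Data.List.Relation.Unary.Unique.Propositional using (Unique)
import Data.List.Relation.Unary.Unique.Propositional.Properties as Uniqueₚ
open import Data.Nat using (zero; suc; pred; _<_; _+_; z≤n; s≤s)
open import Data.Nat.Properties using (≤-trans; ≤-reflexive; m≤m+n; +-suc; +-comm; +-assoc; +-identityʳ; *-suc; +-monoʳ-≤; n≤1+n; ≤-<-trans; <-≤-trans; <-irrefl; m≤n⇒m<n∨m≡n; +-mono-≤; *-monoʳ-≤; ≰⇒>; _≤?_; n≮0)
open import Data.Nat.Solver using (module +-*-Solver)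
open import Data.Product using (_×_; _,_; proj₁; proj₂)
open import Data.Sum using (_⊎_; inj₁; inj₂; [_,_]′)
open import Data.Vec using (Vec; []; _∷_; head; tail; lookup; replicate; tabulate; zipWith; _[_]≔_) renaming (map to vmap; here to hereᵥ; there to thereᵥ)
open import Data.Vec.Properties using (lookup∘update; lookup∘update′; lookup∘tabulate; []≔-commutes; []≔-lookup; ≡-dec; ∷-injectiveʳ)
open import Function using (_∘_)
open import Relation.Binary.PropositionalEquality as ≡ using (_≡_; _≢_; _≗_; refl; sym; cong; cong₂; subst) renaming (trans to ≡-trans)
open import Relation.Nullary using (¬_; Dec; yes; no; ¬?)
open import Relation.Nullary.Decidable using (⌊_⌋; _×-dec_)

-- Restrict all polynomials over 𝔽₂ to total functions from pigeons to holes, and let Kernel k be the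
-- span of the functions that depend on fewer than k pigeons and vanish when those pigeons are sent
-- to distinct holes. For k ≤ n/3 a function of degree below k that lies in Kernel (k + 1) already
-- lies in Kernel k (kernel-descend). So the property "every choice of one equation from each
-- clause has its product of truth values in the kernel" travels backwards along a refutation of
-- space s < n/6, from a configuration with the empty clause (no choices) to the empty
-- configuration (the empty product), which would put the constant 1 in Kernel 1 = 0.
-- The descent rests on keyLemma: a function of e pigeons whose sum over every cube of pairwise
-- distinct holes is zero agrees, on injections, with a sum of functions of e - 1 pigeons each.

variable
  N n : ℕ

-- Arithmetic over 𝔽₂ and linear spans of Boolean functions.

xor-interchange : ∀ a b c d → (a xor b) xor (c xor d) ≡ (a xor c) xor (b xor d)
xor-interchange = solve 4 (λ a b c d → (a :+ b) :+ (c :+ d) := (a :+ c) :+ (b :+ d)) refl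
  where open xor-∧-Solver

∧-xor-distribˡ : ∀ a b c → a ∧ (b xor c) ≡ (a ∧ b) xor (a ∧ c)
∧-xor-distribˡ true  b c = refl
∧-xor-distribˡ false b c = refl

xor-cancelˡ : ∀ a b → a xor (a xor b) ≡ b
xor-cancelˡ a b = ≡-trans (sym (xor-assoc a a b)) (cong (_xor b) (xor-same a))

-- `resp` makes membership depend only on the values of a function, so sums may be rewritten
-- pointwise.
data Span {X : Set} (G : (X → Bool) → Set) : (X → Bool) → Set where
  gen  : ∀ {g} → G g → Span G g
  null : Span G (λ _ → false)
  add  : ∀ {g h} → Span G g → Span G h → Span G (λ x → g x xor h x)
  resp : ∀ {g h} → g ≗ h → Span G g → Span G h

-- Precomposing with `φ` and then multiplying by `a` is 𝔽₂-linear, so generators suffice. A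
-- constantly true `a` gives the pullback along `φ`; the identity for `φ` gives multiplication by
-- `a`.
span-map : {X Y : Set} {G : (X → Bool) → Set} {G′ : (Y → Bool) → Set}
           (a : Y → Bool) (φ : Y → X) →
           (∀ {h} → G h → Span G′ (λ y → a y ∧ h (φ y))) →
           ∀ {g} → Span G g → Span G′ (λ y → a y ∧ g (φ y))
span-map a φ f (gen x)    = f x
span-map a φ f null       = resp (λ y → sym (∧-zeroʳ (a y))) null
span-map a φ f (add s t)  = resp (λ y → sym (∧-xor-distribˡ (a y) _ _))
                                 (add (span-map a φ f s) (span-map a φ f t))
span-map a φ f (resp e s) = resp (λ y → cong (a y ∧_) (e (φ y))) (span-map a φ f s)

span-mono : {X : Set} {G G′ : (X → Bool) → Set} → (∀ {h} → G h → G′ h) → ∀ {g} → Span G g → Span G′ g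
span-mono f = span-map (λ _ → true) (λ x → x) (λ x → gen (f x))

∑ : (Fin n → Bool) → Bool
∑ {zero}  F = false
∑ {suc n} F = F zero xor ∑ (F ∘ suc)

∑-zero : (F : Fin n → Bool) → (∀ j → F j ≡ false) → ∑ F ≡ false
∑-zero {zero}  F z = refl
∑-zero {suc n} F z = cong₂ _xor_ (z zero) (∑-zero (F ∘ suc) (z ∘ suc))

∑-single : (F : Fin n → Bool) (i : Fin n) → (∀ j → j ≢ i → F j ≡ false) → ∑ F ≡ F i
∑-single F zero    z = ≡-trans (cong (F zero xor_) (∑-zero (F ∘ suc) (λ j → z (suc j) (λ ())))) (xor-identityʳ _)
∑-single F (suc i) z = cong₂ _xor_ (z zero (λ ())) (∑-single (F ∘ suc) i (λ j j≢i → z (suc j) (j≢i ∘ suc-injective)))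

isYes-true : {A : Set} (d : Dec A) → A → ⌊ d ⌋ ≡ true
isYes-true (yes _) _ = refl
isYes-true (no ¬a) a = ⊥-elim (¬a a)

isYes-false : {A : Set} (d : Dec A) → ¬ A → ⌊ d ⌋ ≡ false
isYes-false (yes a) ¬a = ⊥-elim (¬a a)
isYes-false (no _)  _  = refl

∑-select : (i : Fin n) (F : Fin n → Bool) → ∑ (λ j → ⌊ i ≟ j ⌋ ∧ F j) ≡ F i
∑-select i F = ≡-trans (∑-single _ i (λ j j≢i → cong (_∧ F j) (isYes-false (i ≟ j) (j≢i ∘ sym))))
                       (cong (_∧ F i) (isYes-true (i ≟ i) refl))

span-∑ : {X : Set} {G : (X → Bool) → Set} (F : Fin n → X → Bool) →
         (∀ j → Span G (F j)) → Span G (λ x → ∑ (λ j → F j x))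
span-∑ {zero}  F s = null
span-∑ {suc n} F s = add (s zero) (span-∑ (F ∘ suc) (s ∘ suc))

-- If `L` contained every hole, sending a hole to its position in `L` would inject `Fin n` into
-- fewer than `n` positions.
fresh : (L : List (Fin n)) → length L < n → ∃[ b ] b ∉ L
fresh L l<n with any? (λ b → ¬? (mem? _≟_ b L))
... | yes p = p
... | no ¬p = ⊥-elim (<⇒≢ i<j (Membershipₛ.index-injective (≡.setoid _) (all i) (all j) eq))
  where
  all : ∀ b → b ∈ L
  all b with mem? _≟_ b L
  ... | yes q = q
  ... | no ¬q = ⊥-elim (¬p (b , ¬q))
  ph = pigeonhole l<n (λ b → index (all b))
  i = proj₁ ph
  j = proj₁ (proj₂ ph)
  i<j = proj₁ (proj₂ (proj₂ ph))
  eq = proj₂ (proj₂ (proj₂ ph))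

∉-∷ : {b c : Fin n} {L : List (Fin n)} → b ≢ c → b ∉ L → b ∉ c ∷ L
∉-∷ b≢c b∉L (here e)  = b≢c e
∉-∷ b≢c b∉L (there p) = b∉L p

-- Functions on placements of pigeons, and their sums over cubes.

-- Pigeons are indexed by Fin N, holes by Fin n; functionality and the pigeon axioms are built into the points.
Poly : ℕ → ℕ → Set
Poly N n = Vec (Fin n) N → Bool

InjOn : (Fin N → Set) → Vec (Fin n) N → Set
InjOn D f = ∀ {i j} → D i → D j → lookup f i ≡ lookup f j → i ≡ j

Avoids : (Fin N → Set) → List (Fin n) → Vec (Fin n) N → Set
Avoids D L f = ∀ {i} → D i → lookup f i ∉ L

Dep : (Fin N → Set) → Poly N n → Set
Dep D h = ∀ f g → (∀ j → D j → lookup f j ≡ lookup g j) → h f ≡ h g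

VanishOn : (Fin N → Set) → List (Fin n) → Poly N n → Set
VanishOn D L h = ∀ f → InjOn D f → Avoids D L f → h f ≡ false

Δ : Fin N → Fin n → Fin n → Poly N n → Poly N n
Δ i c d h f = h (f [ i ]≔ c) xor h (f [ i ]≔ d)

-- h sums to zero over every cube ∏ᵢ {cᵢ, dᵢ} (i ∈ Q) whose holes are pairwise distinct and avoid L.
CubeNull : List (Fin N) → List (Fin n) → Poly N n → Set
CubeNull []      L h = ∀ f → h f ≡ false
CubeNull (i ∷ Q) L h = ∀ c d → c ∉ L → d ∉ L → c ≢ d → CubeNull Q (c ∷ d ∷ L) (Δ i c d h)

update-agree : {D : Fin N → Set} (i : Fin N) (c : Fin n) {f g : Vec (Fin n) N} →
               (∀ j → D j → j ≢ i → lookup f j ≡ lookup g j) →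
               ∀ j → D j → lookup (f [ i ]≔ c) j ≡ lookup (g [ i ]≔ c) j
update-agree i c {f} {g} e j Dj with j ≟ i
... | yes refl = ≡-trans (lookup∘update i f c) (sym (lookup∘update i g c))
... | no j≢i   = ≡-trans (lookup∘update′ j≢i f c) (≡-trans (e j Dj j≢i) (sym (lookup∘update′ j≢i g c)))

Dep-mono : {D D′ : Fin N → Set} {h : Poly N n} → (∀ {j} → D j → D′ j) → Dep D h → Dep D′ h
Dep-mono s dep f g e = dep f g (λ j Dj → e j (s Dj))

Dep-update : {D : Fin N → Set} {h : Poly N n} (i : Fin N) (c : Fin n) →
             Dep D h → Dep (λ j → D j × j ≢ i) (λ f → h (f [ i ]≔ c))
Dep-update i c dep f g e = dep _ _ (update-agree i c {f} {g} (λ j Dj j≢i → e j (Dj , j≢i)))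

Dep-xor : {D : Fin N → Set} {g h : Poly N n} → Dep D g → Dep D h → Dep D (λ f → g f xor h f)
Dep-xor p q f g e = cong₂ _xor_ (p f g e) (q f g e)

Dep-∧ : {D : Fin N → Set} {g h : Poly N n} → Dep D g → Dep D h → Dep D (λ f → g f ∧ h f)
Dep-∧ p q f g e = cong₂ _∧_ (p f g e) (q f g e)

Dep-test : (i : Fin N) (c : Fin n) → Dep (_≡ i) (λ f → ⌊ lookup f i ≟ c ⌋)
Dep-test i c f g e = cong (λ b → ⌊ b ≟ c ⌋) (e i refl)

Dep-Δ : {D : Fin N → Set} {h : Poly N n} (i : Fin N) (c d : Fin n) → Dep D h → Dep D (Δ i c d h)
Dep-Δ i c d dep = Dep-xor (Dep-mono proj₁ (Dep-update i c dep)) (Dep-mono proj₁ (Dep-update i d dep))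

span-Dep : {D : Fin N → Set} {G : Poly N n → Set} → (∀ {h} → G h → Dep D h) → ∀ {h} → Span G h → Dep D h
span-Dep p (gen x)    = p x
span-Dep p null       = λ f g e → refl
span-Dep p (add s t)  = Dep-xor (span-Dep p s) (span-Dep p t)
span-Dep p (resp e s) f g a = ≡-trans (sym (e f)) (≡-trans (span-Dep p s f g a) (e g))

CubeNull-resp : (Q : List (Fin N)) {L : List (Fin n)} {g h : Poly N n} → g ≗ h → CubeNull Q L g → CubeNull Q L h
CubeNull-resp []      e z = λ f → ≡-trans (sym (e f)) (z f)
CubeNull-resp (i ∷ Q) e z = λ c d c∉L d∉L c≢d → CubeNull-resp Q (λ f → cong₂ _xor_ (e _) (e _)) (z c d c∉L d∉L c≢d)

CubeNull-null : (Q : List (Fin N)) {L : List (Fin n)} → CubeNull Q L (λ _ → false)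
CubeNull-null []      = λ _ → refl
CubeNull-null (i ∷ Q) = λ _ _ _ _ _ → CubeNull-null Q

CubeNull-add : (Q : List (Fin N)) {L : List (Fin n)} {g h : Poly N n} →
               CubeNull Q L g → CubeNull Q L h → CubeNull Q L (λ f → g f xor h f)
CubeNull-add []      z w = λ f → cong₂ _xor_ (z f) (w f)
CubeNull-add (i ∷ Q) {g = g} {h} z w = λ c d c∉L d∉L c≢d →
  CubeNull-resp Q (λ f → xor-interchange (g (f [ i ]≔ c)) (g (f [ i ]≔ d)) (h (f [ i ]≔ c)) (h (f [ i ]≔ d)))
    (CubeNull-add Q (z c d c∉L d∉L c≢d) (w c d c∉L d∉L c≢d))

CubeNull-mono : (Q : List (Fin N)) {L L′ : List (Fin n)} {h : Poly N n} →
                (∀ {b} → b ∈ L → b ∈ L′) → CubeNull Q L h → CubeNull Q L′ h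
CubeNull-mono []      s z = z
CubeNull-mono (i ∷ Q) s z = λ c d c∉L d∉L c≢d → CubeNull-mono Q ext (z c d (c∉L ∘ s) (d∉L ∘ s) c≢d)
  where
  ext : ∀ {b c d} → b ∈ c ∷ d ∷ _ → b ∈ c ∷ d ∷ _
  ext (here e)          = here e
  ext (there (here e))  = there (here e)
  ext (there (there p)) = there (there (s p))

-- Updates at distinct pigeons commute, so exchanging two directions only permutes the four corners
-- of a square and the order of the excluded holes.
CubeNull-perm : {Q Q′ : List (Fin N)} {L : List (Fin n)} {h : Poly N n} →
                Q ↭ Q′ → CubeNull Q L h → CubeNull Q′ L h
CubeNull-perm refl z = z
CubeNull-perm (prep i p) z = λ c d c∉L d∉L c≢d → CubeNull-perm p (z c d c∉L d∉L c≢d)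
CubeNull-perm (trans p q) z = CubeNull-perm q (CubeNull-perm p z)
CubeNull-perm {h = h} (swap i j p) z with i ≟ j
... | yes refl = λ c d c∉L d∉L c≢d c′ d′ c′∉ d′∉ c′≢d′ → CubeNull-perm p (z c d c∉L d∉L c≢d c′ d′ c′∉ d′∉ c′≢d′)
... | no i≢j   = λ c d c∉L d∉L c≢d c′ d′ c′∉ d′∉ c′≢d′ →
  let commute = λ f {x} {y} → cong h ([]≔-commutes {x = x} {y = y} f j i (i≢j ∘ sym)) in
  CubeNull-perm p (CubeNull-mono _ exchange
    (CubeNull-resp _
      (λ f → ≡-trans (xor-interchange (h (f [ j ]≔ c [ i ]≔ c′)) (h (f [ j ]≔ c [ i ]≔ d′))
                                       (h (f [ j ]≔ d [ i ]≔ c′)) (h (f [ j ]≔ d [ i ]≔ d′)))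
        (cong₂ _xor_ (cong₂ _xor_ (commute f) (commute f)) (cong₂ _xor_ (commute f) (commute f))))
      (z c′ d′ (c′∉ ∘ there ∘ there) (d′∉ ∘ there ∘ there) c′≢d′
         c d (∉-∷ (c′∉ ∘ here ∘ sym) (∉-∷ (d′∉ ∘ here ∘ sym) c∉L))
             (∉-∷ (c′∉ ∘ there ∘ here ∘ sym) (∉-∷ (d′∉ ∘ there ∘ here ∘ sym) d∉L))
         c≢d)))
  where
  exchange : ∀ {a b c d e : Fin _} {L} → e ∈ a ∷ b ∷ c ∷ d ∷ L → e ∈ c ∷ d ∷ a ∷ b ∷ L
  exchange (here p)                          = there (there (here p))
  exchange (there (here p))                  = there (there (there (here p)))
  exchange (there (there (here p)))          = here p
  exchange (there (there (there (here p))))  = there (here p)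
  exchange (there (there (there (there p)))) = there (there (there (there p)))

-- Placing pigeons in free holes and transferring cube sums.

good-update : (r : Fin N) (T : List (Fin N)) (L : List (Fin n)) (f : Vec (Fin n) N) (b : Fin n) → r ∉ T → b ∉ L →
              (∀ {j} → j ∈ T → lookup f j ≢ b) → InjOn (_∈ T) f → Avoids (_∈ T) L f →
              InjOn (_∈ r ∷ T) (f [ r ]≔ b) × Avoids (_∈ r ∷ T) L (f [ r ]≔ b)
good-update r T L f b r∉T b∉L f≢b inj av = inj′ , av′
  where
  at-r : lookup (f [ r ]≔ b) r ≡ b
  at-r = lookup∘update r f b
  at-T : ∀ {j} → j ∈ T → lookup (f [ r ]≔ b) j ≡ lookup f j
  at-T j∈T = lookup∘update′ (λ { refl → r∉T j∈T }) f b
  inj′ : InjOn (_∈ r ∷ T) (f [ r ]≔ b)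
  inj′ (here refl) (here refl) e = refl
  inj′ (here refl) (there q)   e = ⊥-elim (f≢b q (≡-trans (sym (at-T q)) (≡-trans (sym e) at-r)))
  inj′ (there p)   (here refl) e = ⊥-elim (f≢b p (≡-trans (sym (at-T p)) (≡-trans e at-r)))
  inj′ (there p)   (there q)   e = inj p q (≡-trans (sym (at-T p)) (≡-trans e (at-T q)))
  av′ : Avoids (_∈ r ∷ T) L (f [ r ]≔ b)
  av′ (here refl) = subst (_∉ L) (sym at-r) b∉L
  av′ (there p)   = subst (_∉ L) (sym (at-T p)) (av p)

-- Pigeons of `T` avoid both `c` and `d`, so at either end of the edge pigeon `r` extends the
-- injection, and both summands of the difference vanish.
VanishOn-Δ : (r : Fin N) (T : List (Fin N)) (L : List (Fin n)) {h : Poly N n} {c d : Fin n} →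
             r ∉ T → c ∉ L → d ∉ L → VanishOn (_∈ r ∷ T) L h → VanishOn (_∈ T) (c ∷ d ∷ L) (Δ r c d h)
VanishOn-Δ r T L {h} {c} {d} r∉T c∉L d∉L v f inj av =
  cong₂ _xor_ (part c c∉L (λ p e → av p (here e))) (part d d∉L (λ p e → av p (there (here e))))
  where
  part : ∀ b → b ∉ L → (∀ {j} → j ∈ T → lookup f j ≢ b) → h (f [ r ]≔ b) ≡ false
  part b b∉L f≢b with inj′ , av′ ← good-update r T L f b r∉T b∉L f≢b inj (λ p q → av p (there (there q))) = v _ inj′ av′

-- Greedy placement: each pigeon of `S` reserves a hole outside `L`, which then joins `L` for the
-- others. The count ensures that a free hole is always left.
spread : (S : List (Fin N)) → Unique S → (L : List (Fin n)) (f : Vec (Fin n) N) → length L + length S ≤ n →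
         ∃[ f′ ] (∀ j → j ∉ S → lookup f′ j ≡ lookup f j) × InjOn (_∈ S) f′ × Avoids (_∈ S) L f′
spread [] u L f le = f , (λ _ _ → refl) , (λ ()) , (λ ())
spread (s ∷ S) (s∉S ∷ u) L f le
  with b , b∉L ← fresh L (≤-trans (s≤s (m≤m+n _ _)) (≤-trans (≤-reflexive (sym (+-suc (length L) (length S)))) le))
  with f′ , same , inj , av ← spread S u (b ∷ L) f (≤-trans (≤-reflexive (sym (+-suc (length L) (length S)))) le)
  with inj′ , av′ ← good-update s S L f′ b (All¬⇒¬Any s∉S) b∉L (λ p e → av p (here e)) inj (λ p q → av p (there q))
  = f′ [ s ]≔ b , (λ j j∉ → ≡-trans (lookup∘update′ (λ e → j∉ (here e)) f′ b) (same j (λ p → j∉ (there p)))) , inj′ , av′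

peel-length : ∀ l e → l + 2 * suc e ≡ suc (suc l) + 2 * e
peel-length l e = ≡-trans (cong (l +_) (*-suc 2 e)) (≡-trans (+-suc l _) (cong suc (+-suc l _)))

peel-≤ : ∀ l e k {m} → l + 2 * suc e + k ≤ m → suc (suc l) + 2 * e + k ≤ m
peel-≤ l e k = ≤-trans (≤-reflexive (cong (_+ k) (sym (peel-length l e))))

-- After the cube along `R` has used two holes per direction, there is still room to place `S`
-- injectively away from it. Then `h` vanishes at every corner, while `g` does not see where `S` is
-- placed, so the cube sum of `g` equals that of `h + g`.
CubeNull-restrict :
  (S R : List (Fin N)) (L : List (Fin n)) {h g : Poly N n} → Unique (R ++ S) →
  VanishOn (_∈ R ++ S) L h → CubeNull R L (λ f → h f xor g f) → Dep (_∉ S) g →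
  length L + 2 * length R + length S ≤ n → CubeNull R L g
CubeNull-restrict S [] L {h} {g} u v z dep le f
  -- By now `L` includes the holes of all cube directions, so `S` is placed away from them.
  with f′ , same , inj , av ← spread S u L f (subst (λ x → x + length S ≤ _) (+-identityʳ _) le)
  = ≡-trans (sym (dep f′ f same)) (≡-trans (cong (_xor g f′) (sym (v f′ inj av))) (z f′))
CubeNull-restrict S (r ∷ R) L {h} {g} (r∉ ∷ u) v z dep le c d c∉L d∉L c≢d =
  CubeNull-restrict S R (c ∷ d ∷ L) u
    (VanishOn-Δ r (R ++ S) L {h} (All¬⇒¬Any r∉) c∉L d∉L v)
    (CubeNull-resp R (λ f → xor-interchange (h (f [ r ]≔ c)) (g (f [ r ]≔ c)) (h (f [ r ]≔ d)) (g (f [ r ]≔ d))) (z c d c∉L d∉L c≢d))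
    (Dep-Δ r c d dep)
    (peel-≤ (length L) (length R) (length S) le)

-- The hole b can only be chosen after the cube, so the hypothesis quantifies over all b.
CubeNull-star :
  (i : Fin N) (s : Fin n) (R : List (Fin N)) (L : List (Fin n)) {h : Poly N n} → Unique (R ++ i ∷ []) →
  VanishOn (_∈ R ++ i ∷ []) L h → (∀ b → b ∉ L → CubeNull R (b ∷ L) (Δ i s b h)) →
  length L + 2 * length R + 1 ≤ n → CubeNull R L (λ f → h (f [ i ]≔ s))
CubeNull-star i s [] L {h} u v z le f
  with b , b∉L ← fresh L (≤-trans (≤-reflexive (sym (≡-trans (cong (_+ 1) (+-identityʳ (length L))) (+-comm (length L) 1)))) le)
  with inj , av ← good-update i [] L f b (λ ()) b∉L (λ ()) (λ ()) (λ ())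
  = ≡-trans (sym (xor-identityʳ _)) (≡-trans (cong (h (f [ i ]≔ s) xor_) (sym (v _ inj av))) (z b b∉L f))
CubeNull-star i s (r ∷ R) L {h} (r∉ ∷ u) v z le c d c∉L d∉L c≢d =
  CubeNull-resp R (λ f → cong₂ _xor_ (commute f) (commute f))
    (CubeNull-star i s R (c ∷ d ∷ L) u (VanishOn-Δ r (R ++ i ∷ []) L {h} (All¬⇒¬Any r∉) c∉L d∉L v) z′
      (peel-≤ (length L) (length R) 1 le))
  where
  r≢i : r ≢ i
  r≢i e = All¬⇒¬Any r∉ (∈-++⁺ʳ R (here e))
  commute : ∀ f {x y} → h (f [ i ]≔ x [ r ]≔ y) ≡ h (f [ r ]≔ y [ i ]≔ x)
  commute f = cong h ([]≔-commutes f i r (r≢i ∘ sym))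
  rotate : ∀ {b e} → e ∈ c ∷ d ∷ b ∷ L → e ∈ b ∷ c ∷ d ∷ L
  rotate (here p)                  = there (here p)
  rotate (there (here p))          = there (there (here p))
  rotate (there (there (here p)))  = here p
  rotate (there (there (there p))) = there (there (there p))
  z′ : ∀ b → b ∉ c ∷ d ∷ L → CubeNull R (b ∷ c ∷ d ∷ L) (Δ i s b (Δ r c d h))
  z′ b b∉ = CubeNull-mono R rotate
    (CubeNull-resp R
      (λ f → ≡-trans (xor-interchange (h (f [ r ]≔ c [ i ]≔ s)) (h (f [ r ]≔ c [ i ]≔ b))
                                      (h (f [ r ]≔ d [ i ]≔ s)) (h (f [ r ]≔ d [ i ]≔ b)))
               (sym (cong₂ _xor_ (cong₂ _xor_ (commute f) (commute f)) (cong₂ _xor_ (commute f) (commute f)))))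
      (z b (b∉ ∘ there ∘ there) c d (∉-∷ (b∉ ∘ here ∘ sym) c∉L) (∉-∷ (b∉ ∘ there ∘ here ∘ sym) d∉L) c≢d))

-- The two ends of every edge in direction `i` carry the same value, so the corners of the cube
-- cancel in pairs.
CubeNull-Dep : (i : Fin N) (Q : List (Fin N)) (L : List (Fin n)) {h : Poly N n} → i ∈ Q → Dep (_≢ i) h → CubeNull Q L h
CubeNull-Dep i (.i ∷ Q) L {h} (here refl) dep c d c∉L d∉L c≢d =
  CubeNull-resp Q (λ f → sym (≡-trans
      (cong (h (f [ i ]≔ c) xor_)
            (dep _ _ (λ j j≢i → ≡-trans (lookup∘update′ j≢i f d) (sym (lookup∘update′ j≢i f c)))))
      (xor-same (h (f [ i ]≔ c)))))
    (CubeNull-null Q)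
CubeNull-Dep i (r ∷ Q) L (there i∈Q) dep c d c∉L d∉L c≢d = CubeNull-Dep i Q (c ∷ d ∷ L) i∈Q (Dep-Δ r c d dep)

-- Reduction of cube-null functions to fewer pigeons.

Independent : List (Fin N) → Poly N n → Set
Independent Q h = ∃[ i ] i ∈ Q × Dep (_≢ i) h

CubeNull-span : (Q : List (Fin N)) (L : List (Fin n)) {h : Poly N n} → Span (Independent Q) h → CubeNull Q L h
CubeNull-span Q L (gen (i , i∈Q , dep)) = CubeNull-Dep i Q L i∈Q dep
CubeNull-span Q L null       = CubeNull-null Q
CubeNull-span Q L (add s t)  = CubeNull-add Q (CubeNull-span Q L s) (CubeNull-span Q L t)
CubeNull-span Q L (resp e s) = CubeNull-resp Q e (CubeNull-span Q L s)

Unique-resp-↭ : {Q R : List (Fin N)} → Q ↭ R → Unique Q → Unique R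
Unique-resp-↭ p = Permutationₛ.Unique-resp-↭ (≡.setoid _) (↭⇒↭ₛ p)

extract : {t : Fin N} {Q : List (Fin N)} → t ∈ Q → ∃[ R ] Q ↭ t ∷ R
extract {t = t} t∈Q with ys , zs , refl ← ∈-∃++ t∈Q = ys ++ zs , shift t ys zs

-- Unlike `Independent`, this also forbids dependence on pigeons outside `Q`.
Smaller : List (Fin N) → Poly N n → Set
Smaller Q h = ∃[ i ] i ∈ Q × Dep (λ j → j ∈ Q × j ≢ i) h

smaller-independent : {Q : List (Fin N)} {h : Poly N n} → Smaller Q h → Independent Q h
smaller-independent (i , i∈Q , dep) = i , i∈Q , Dep-mono proj₂ dep

smaller-Dep : {Q : List (Fin N)} {h : Poly N n} → Span (Smaller Q) h → Dep (_∈ Q) h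
smaller-Dep = span-Dep (λ (_ , _ , dep) → Dep-mono proj₁ dep)

-- The pigeon of `R` that `h` ignores differs from `t` by uniqueness, so the indicator does not
-- bring it back.
smaller-∷ : {t : Fin N} {R Q : List (Fin N)} {h : Poly N n} (c : Fin n) → Unique (t ∷ R) → (∀ {j} → j ∈ t ∷ R → j ∈ Q) →
            Smaller R h → Smaller Q (λ f → ⌊ lookup f t ≟ c ⌋ ∧ h f)
smaller-∷ {t = t} c (t∉R ∷ _) R⊆Q (i , i∈R , dep) = i , R⊆Q (there i∈R) ,
  Dep-∧ (Dep-mono (λ { refl → R⊆Q (here refl) , λ { refl → All¬⇒¬Any t∉R i∈R } }) (Dep-test t c))
        (Dep-mono (λ (j∈R , j≢i) → R⊆Q (there j∈R) , j≢i) dep)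

Reducible : List (Fin N) → List (Fin n) → Poly N n → Set
Reducible Q L g = ∃[ w ] Span (Smaller Q) w × (∀ f → InjOn (_∈ Q) f → Avoids (_∈ Q) L f → g f ≡ w f)

-- A predicate of `e`, so that `reduce-star` can take it as induction hypothesis. The count reserves
-- two holes outside `L` for every pigeon of `Q`.
KeyLemma : ℕ → ℕ → ℕ → Set
KeyLemma N n e = (Q : List (Fin N)) (L : List (Fin n)) (g : Poly N n) → length Q ≡ e → Unique Q →
                 length L + 2 * e ≤ n → Dep (_∈ Q) g → CubeNull Q L g → Reducible Q L g

reducible-add : {Q : List (Fin N)} {L : List (Fin n)} {g u : Poly N n} → Span (Smaller Q) u →
                Reducible Q L (λ f → g f xor u f) → Reducible Q L g
reducible-add {g = g} {u} su (w , sw , eq) = _ , add su sw ,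
  λ f inj av → ≡-trans (sym (xor-cancelˡ (u f) (g f))) (cong (u f xor_) (≡-trans (xor-comm (u f) (g f)) (eq f inj av)))

xor-vanish : ∀ {a b} → a ≡ b → a xor b ≡ false
xor-vanish {a} refl = xor-same a

-- Induction on `T`, the pigeons whose presence in hole `s` may make `h` nonzero. Fixing `t` at `s`
-- gives a function that is cube-null in the other pigeons: while these avoid `s`, moving `t` to
-- another free hole `b` lands where `h` vanishes. The hypothesis replaces this function by a
-- smaller one, and subtracting that one times the indicator of `t` at `s` removes `t` from `T`.
reduce-star : ∀ {e} → KeyLemma N n e →
  (Q : List (Fin N)) (L : List (Fin n)) (s : Fin n) → length Q ≡ suc e → Unique Q →
  length L + 2 * suc e ≤ n → s ∉ L →
  (T : List (Fin N)) → (∀ {i} → i ∈ T → i ∈ Q) → (h : Poly N n) → Dep (_∈ Q) h → CubeNull Q L h →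
  (∀ f → InjOn (_∈ Q) f → Avoids (_∈ Q) L f → (∀ {i} → i ∈ T → lookup f i ≢ s) → h f ≡ false) →
  Reducible Q L h
reduce-star IH Q L s len uQ le s∉L [] T⊆Q h dep z v = (λ _ → false) , null , λ f inj av → v f inj av (λ ())
reduce-star {n = n} {e = e} IH Q L s len uQ le s∉L (t ∷ T) T⊆Q h dep z v with extract (T⊆Q (here refl))
... | R , Q↭ = reducible-add su
        (reduce-star IH Q L s len uQ le s∉L T (T⊆Q ∘ there) (λ f → h f xor u f) (Dep-xor dep (smaller-Dep su))
          -- Each summand of `u` ignores a pigeon of `Q`, so subtracting `u` keeps the function
          -- cube-null.
          (CubeNull-add Q z (CubeNull-span Q L (span-mono smaller-independent su))) v′)
  where
  uR : Unique (t ∷ R)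
  uR = Unique-resp-↭ Q↭ uQ
  toQ : ∀ {j} → j ∈ t ∷ R → j ∈ Q
  toQ = ∈-resp-↭ (↭-sym Q↭)
  lenR : length R ≡ e
  lenR = cong pred (≡-trans (sym (↭-length Q↭)) len)
  le′ : suc (suc (length L)) + 2 * e ≤ n
  le′ = ≤-trans (≤-reflexive (sym (peel-length (length L) e))) le
  R∷t : R ++ t ∷ [] ↭ t ∷ R
  R∷t = ++-comm R (t ∷ [])
  v-star : VanishOn (_∈ R ++ t ∷ []) (s ∷ L) h
  v-star f inj av = v f (λ p q → inj (fromQ p) (fromQ q)) (λ p q → av (fromQ p) (there q)) (λ p e → av (fromQ (T⊆Q p)) (here e))
    where
    fromQ : ∀ {j} → j ∈ Q → j ∈ R ++ t ∷ []
    fromQ p = ∈-resp-↭ (↭-sym R∷t) (∈-resp-↭ Q↭ p)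
  z-star : CubeNull R (s ∷ L) (λ f → h (f [ t ]≔ s))
  z-star = CubeNull-star t s R (s ∷ L) (Unique-resp-↭ (↭-sym R∷t) uR) v-star
    (λ b b∉ → CubeNull-mono R swap₂ (CubeNull-perm Q↭ z s b s∉L (b∉ ∘ there) (b∉ ∘ here ∘ sym)))
    (≤-trans (≤-reflexive (≡-trans (+-comm _ 1) (cong (λ x → suc (suc (length L + 2 * x))) lenR))) le′)
    where
    swap₂ : ∀ {b x} → x ∈ s ∷ b ∷ L → x ∈ b ∷ s ∷ L
    swap₂ (here p)          = there (here p)
    swap₂ (there (here p))  = here p
    swap₂ (there (there p)) = there (there p)
  depR : Dep (_∈ R) (λ f → h (f [ t ]≔ s))
  depR = Dep-mono inR (Dep-update t s dep)
    where
    inR : ∀ {j} → j ∈ Q × j ≢ t → j ∈ R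
    inR (j∈Q , j≢t) with ∈-resp-↭ Q↭ j∈Q
    ... | here e  = ⊥-elim (j≢t e)
    ... | there p = p
  ih = IH R (s ∷ L) _ lenR (AllPairs.tail uR) (≤-trans (n≤1+n _) le′) depR z-star
  u : Poly _ n
  u f = ⌊ lookup f t ≟ s ⌋ ∧ proj₁ ih f
  su : Span (Smaller Q) u
  su = span-map (λ f → ⌊ lookup f t ≟ s ⌋) (λ f → f) (gen ∘ smaller-∷ s uR toQ) (proj₁ (proj₂ ih))
  v′ : ∀ f → InjOn (_∈ Q) f → Avoids (_∈ Q) L f → (∀ {i} → i ∈ T → lookup f i ≢ s) → h f xor u f ≡ false
  v′ f inj av T≢s with lookup f t ≟ s
  ... | yes refl = xor-vanish (≡-trans (cong h (sym ([]≔-lookup f t)))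
                     (proj₂ (proj₂ ih) f (λ p q → inj (toQ (there p)) (toQ (there q))) avoid))
    where
    avoid : Avoids (_∈ R) (lookup f t ∷ L) f
    avoid p (here e)  = All¬⇒¬Any (AllPairs.head uR) (subst (_∈ R) (inj (toQ (there p)) (toQ (here refl)) e) p)
    avoid p (there q) = av (toQ (there p)) q
  ... | no t≢s = ≡-trans (xor-identityʳ _) (v f inj av λ { (here refl) → t≢s ; (there p) → T≢s p })

-- Compare every position `c` of the first pigeon `l` with one fixed hole `s`. The differences
-- `Δ l c s g` reduce by induction, with `c` and `s` forbidden; glued by the indicators of `l` they
-- form `W`. Then `g + base + W` vanishes on injections in which no other pigeon uses `s`, which is
-- the situation of `reduce-star`.
keyLemma : ∀ e → KeyLemma N n e
keyLemma zero    []       L g len u le dep z = (λ _ → false) , null , λ f _ _ → z f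
keyLemma {N} {n} (suc e) (l ∷ Q) L g len uQ@(l∉Q ∷ u) le dep z
  with s , s∉L ← fresh L (≤-trans (s≤s (m≤m+n (length L) _)) (≤-trans (≤-reflexive (sym (+-suc _ _))) le))
  = reducible-add s-base (reducible-add s-W
      (reduce-star (keyLemma e) (l ∷ Q) L s len uQ le s∉L Q there (λ f → (g f xor base f) xor W f)
        (Dep-xor (Dep-xor dep (smaller-Dep s-base)) (smaller-Dep s-W))
        (CubeNull-add (l ∷ Q) {g = λ f → g f xor base f} {W}
          (CubeNull-add (l ∷ Q) {g = g} {base} z (nul s-base)) (nul s-W)) v))
  where
  nul : ∀ {h} → Span (Smaller (l ∷ Q)) h → CubeNull (l ∷ Q) L h
  nul sh = CubeNull-span (l ∷ Q) L (span-mono smaller-independent sh)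
  le′ : suc (suc (length L)) + 2 * e ≤ n
  le′ = ≤-trans (≤-reflexive (sym (peel-length (length L) e))) le
  inQ : ∀ {j} → j ∈ l ∷ Q × j ≢ l → j ∈ Q
  inQ (here e  , j≢l) = ⊥-elim (j≢l e)
  inQ (there p , _)   = p
  base : Poly N n
  base f = g (f [ l ]≔ s)
  s-base : Span (Smaller (l ∷ Q)) base
  s-base = gen (l , here refl , Dep-update l s dep)
  slice : ∀ c → ∃[ w ] Span (Smaller Q) w ×
          (c ∉ L → ∀ f → InjOn (_∈ Q) f → Avoids (_∈ Q) (c ∷ s ∷ L) f → Δ l c s g f ≡ w f)
  slice c with mem? _≟_ c L | c ≟ s
  -- Zero is the right default: placements avoiding `L` never send `l` to a hole of `L`, and for
  -- `c = s` the difference itself is zero.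
  ... | yes c∈L | _        = (λ _ → false) , null , λ c∉L → ⊥-elim (c∉L c∈L)
  ... | no _    | yes refl = (λ _ → false) , null , λ _ f _ _ → xor-same (base f)
  ... | no c∉L  | no c≢s   with w , sw , eq ← keyLemma e Q (c ∷ s ∷ L) (Δ l c s g) (cong pred len) u le′
                                   (Dep-xor (Dep-mono inQ (Dep-update l c dep)) (Dep-mono inQ (Dep-update l s dep)))
                                   (z c s c∉L s∉L c≢s)
                           = w , sw , λ _ → eq
  W : Poly N n
  W f = ∑ (λ c → ⌊ lookup f l ≟ c ⌋ ∧ proj₁ (slice c) f)
  s-W : Span (Smaller (l ∷ Q)) W
  s-W = span-∑ (λ c f → ⌊ lookup f l ≟ c ⌋ ∧ proj₁ (slice c) f) (λ c → span-map _ (λ f → f)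
          (gen ∘ smaller-∷ c uQ (λ p → p)) (proj₁ (proj₂ (slice c))))
  v : ∀ f → InjOn (_∈ l ∷ Q) f → Avoids (_∈ l ∷ Q) L f → (∀ {i} → i ∈ Q → lookup f i ≢ s) → (g f xor base f) xor W f ≡ false
  v f inj av Q≢s = xor-vanish (≡-trans (cong (λ x → g x xor base f) (sym ([]≔-lookup f l)))
      (≡-trans (proj₂ (proj₂ (slice (lookup f l))) (av (here refl)) f (λ p q → inj (there p) (there q)) avoid)
               (sym (∑-select (lookup f l) (λ c → proj₁ (slice c) f)))))
    where
    avoid : Avoids (_∈ Q) (lookup f l ∷ s ∷ L) f
    avoid p (here e)          = All¬⇒¬Any l∉Q (subst (_∈ Q) (inj (there p) (here refl) e) p)
    avoid p (there (here e))  = Q≢s p e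
    avoid p (there (there q)) = av (there p) q

-- Sums indexed by sets of pigeons.

_≟ₛ_ : (P Q : Subset N) → Dec (P ≡ Q)
_≟ₛ_ = ≡-dec _≟ᵇ_

∑ₛ : (Subset N → Bool) → Bool
∑ₛ {zero}  F = F []
∑ₛ {suc N} F = ∑ₛ (F ∘ (true ∷_)) xor ∑ₛ (F ∘ (false ∷_))

∑ₛ-zero : (F : Subset N → Bool) → (∀ P → F P ≡ false) → ∑ₛ F ≡ false
∑ₛ-zero {zero}  F z = z []
∑ₛ-zero {suc N} F z = cong₂ _xor_ (∑ₛ-zero (F ∘ (true ∷_)) (z ∘ (true ∷_))) (∑ₛ-zero (F ∘ (false ∷_)) (z ∘ (false ∷_)))

∑ₛ-single : (F : Subset N → Bool) (P : Subset N) → (∀ Q → Q ≢ P → F Q ≡ false) → ∑ₛ F ≡ F P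
∑ₛ-single F []          z = refl
∑ₛ-single F (true ∷ P)  z = ≡-trans (cong₂ _xor_ (∑ₛ-single (F ∘ (true ∷_)) P (λ Q Q≢P → z _ (Q≢P ∘ ∷-injectiveʳ)))
                                                 (∑ₛ-zero (F ∘ (false ∷_)) (λ Q → z _ (λ ()))))
                                    (xor-identityʳ _)
∑ₛ-single F (false ∷ P) z = cong₂ _xor_ (∑ₛ-zero (F ∘ (true ∷_)) (λ Q → z _ (λ ())))
                                        (∑ₛ-single (F ∘ (false ∷_)) P (λ Q Q≢P → z _ (Q≢P ∘ ∷-injectiveʳ)))

∑ₛ-cong : {F G : Subset N → Bool} → F ≗ G → ∑ₛ F ≡ ∑ₛ G
∑ₛ-cong {zero}  e = e []
∑ₛ-cong {suc N} e = cong₂ _xor_ (∑ₛ-cong (e ∘ (true ∷_))) (∑ₛ-cong (e ∘ (false ∷_)))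

∑ₛ-xor : (F G : Subset N → Bool) → ∑ₛ (λ P → F P xor G P) ≡ ∑ₛ F xor ∑ₛ G
∑ₛ-xor {zero}  F G = refl
∑ₛ-xor {suc N} F G = ≡-trans (cong₂ _xor_ (∑ₛ-xor (F ∘ (true ∷_)) (G ∘ (true ∷_))) (∑ₛ-xor (F ∘ (false ∷_)) (G ∘ (false ∷_))))
                             (xor-interchange (∑ₛ (F ∘ (true ∷_))) (∑ₛ (G ∘ (true ∷_))) _ _)

span-∑ₛ : {X : Set} {G : (X → Bool) → Set} (F : Subset N → X → Bool) →
          (∀ P → Span G (F P)) → Span G (λ x → ∑ₛ (λ P → F P x))
span-∑ₛ {zero}  F s = s []
span-∑ₛ {suc N} F s = add (span-∑ₛ (F ∘ (true ∷_)) (s ∘ (true ∷_))) (span-∑ₛ (F ∘ (false ∷_)) (s ∘ (false ∷_)))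

at : Subset N → Bool → Subset N → Bool
at P b Q = ⌊ Q ≟ₛ P ⌋ ∧ b

off : Subset N → Bool → Subset N → Bool
off P b Q = not ⌊ Q ≟ₛ P ⌋ ∧ b

∑ₛ-at : (P : Subset N) (F : Subset N → Bool) → ∑ₛ (λ Q → at P (F Q) Q) ≡ F P
∑ₛ-at P F = ≡-trans (∑ₛ-single _ P (λ Q Q≢P → cong (_∧ F Q) (isYes-false (Q ≟ₛ P) Q≢P)))
                    (cong (_∧ F P) (isYes-true (P ≟ₛ P) refl))

-- In characteristic two, adding a term of the sum once more removes it.
∑ₛ-off : (P : Subset N) (F : Subset N → Bool) → ∑ₛ F xor F P ≡ ∑ₛ (λ Q → off P (F Q) Q)
∑ₛ-off P F = ≡-trans (cong (∑ₛ F xor_) (sym (∑ₛ-at P F)))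
                     (≡-trans (sym (∑ₛ-xor F _)) (∑ₛ-cong (λ Q → split ⌊ Q ≟ₛ P ⌋ (F Q))))
  where
  split : ∀ a b → b xor (a ∧ b) ≡ not a ∧ b
  split true  b = xor-same b
  split false b = xor-identityʳ b

-- Generators with the same index are merged, since each family is closed under addition. The zero
-- alternative serves sets that index no generator, as `G P` need not contain zero.
collect : {X : Set} (G : Subset N → (X → Bool) → Set) →
          (∀ {P g h} → G P g → G P h → G P (λ x → g x xor h x)) →
          (∀ {P g h} → g ≗ h → G P g → G P h) →
          ∀ {g} → Span (λ h → ∃[ P ] G P h) g →
          ∃[ F ] (∀ P → G P (F P) ⊎ (∀ x → F P x ≡ false)) × (∀ x → g x ≡ ∑ₛ (λ P → F P x))
collect {X = X} G ⊕ ≈ (gen {g} (P , p)) = (λ Q x → at P (g x) Q) , part , λ x → sym (∑ₛ-at P (λ _ → g x))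
  where
  part : ∀ Q → G Q (λ x → at P (g x) Q) ⊎ ((x : X) → at P (g x) Q ≡ false)
  part Q with Q ≟ₛ P
  ... | yes refl = inj₁ p
  ... | no _     = inj₂ (λ _ → refl)
collect {N = N} G ⊕ ≈ null = (λ _ _ → false) , (λ _ → inj₂ (λ _ → refl)) , λ x → sym (∑ₛ-zero {N} (λ P → false) (λ _ → refl))
collect {X = X} G ⊕ ≈ (add s t) with F , p , e ← collect G ⊕ ≈ s | F′ , p′ , e′ ← collect G ⊕ ≈ t
  = (λ P x → F P x xor F′ P x) , part , λ x → ≡-trans (cong₂ _xor_ (e x) (e′ x)) (sym (∑ₛ-xor (λ P → F P x) (λ P → F′ P x)))
  where
  part : ∀ P → G P (λ x → F P x xor F′ P x) ⊎ ((x : X) → F P x xor F′ P x ≡ false)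
  part P with p P | p′ P
  ... | inj₁ a | inj₁ b = inj₁ (⊕ a b)
  ... | inj₁ a | inj₂ b = inj₁ (≈ (λ x → sym (≡-trans (cong (F P x xor_) (b x)) (xor-identityʳ _))) a)
  ... | inj₂ a | inj₁ b = inj₁ (≈ (λ x → sym (cong (_xor F′ P x) (a x))) b)
  ... | inj₂ a | inj₂ b = inj₂ (λ x → cong₂ _xor_ (a x) (b x))
collect G ⊕ ≈ (resp q s) with F , p , e ← collect G ⊕ ≈ s = F , p , λ x → ≡-trans (sym (q x)) (e x)

-- Sets of pigeons as duplicate-free lists.

elements : Subset N → List (Fin N)
elements []          = []
elements (true ∷ P)  = zero ∷ map suc (elements P)
elements (false ∷ P) = map suc (elements P)

length-elements : (P : Subset N) → length (elements P) ≡ ∣ P ∣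
length-elements []          = refl
length-elements (true ∷ P)  = cong suc (≡-trans (length-map suc (elements P)) (length-elements P))
length-elements (false ∷ P) = ≡-trans (length-map suc (elements P)) (length-elements P)

∈-elements⁺ : {P : Subset N} {i : Fin N} → i ∈ₛ P → i ∈ elements P
∈-elements⁺ {P = true ∷ P}  hereᵥ      = here refl
∈-elements⁺ {P = true ∷ P}  (thereᵥ p) = there (∈-map⁺ suc (∈-elements⁺ p))
∈-elements⁺ {P = false ∷ P} (thereᵥ p) = ∈-map⁺ suc (∈-elements⁺ p)

∈-elements⁻ : (P : Subset N) {i : Fin N} → i ∈ elements P → i ∈ₛ P
∈-elements⁻ (true ∷ P) (here refl) = hereᵥ
∈-elements⁻ (true ∷ P) (there q) with j , j∈ , refl ← ∈-map⁻ suc q = thereᵥ (∈-elements⁻ P j∈)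
∈-elements⁻ (false ∷ P) q        with j , j∈ , refl ← ∈-map⁻ suc q = thereᵥ (∈-elements⁻ P j∈)

elements-unique : (P : Subset N) → Unique (elements P)
elements-unique []          = []
elements-unique (true ∷ P)  = ¬Any⇒All¬ _ zero∉ ∷ Uniqueₚ.map⁺ suc-injective (elements-unique P)
  where
  zero∉ : zero ∉ map suc (elements P)
  zero∉ q with _ , _ , () ← ∈-map⁻ suc q
elements-unique (false ∷ P) = Uniqueₚ.map⁺ suc-injective (elements-unique P)

-- Otherwise `P` would be a proper subset of `Q`, hence strictly smaller.
missing : {P Q : Subset N} → Q ≢ P → ∣ Q ∣ ≤ ∣ P ∣ → ∃[ i ] i ∈ₛ P × i ∉ₛ Q
missing {P = P} {Q} Q≢P le with any? (λ i → (i ∈ₛ? P) ×-dec ¬? (i ∈ₛ? Q))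
... | yes w = w
... | no ¬w = ⊥-elim (<-irrefl refl (<-≤-trans (p⊂q⇒∣p∣<∣q∣ (P⊆Q , extra)) le))
  where
  P⊆Q : P ⊆ₛ Q
  P⊆Q {i} i∈P with i ∈ₛ? Q
  ... | yes i∈Q = i∈Q
  ... | no i∉Q  = ⊥-elim (¬w (i , i∈P , i∉Q))
  extra : ∃[ i ] i ∈ₛ Q × i ∉ₛ P
  extra with any? (λ i → (i ∈ₛ? Q) ×-dec ¬? (i ∈ₛ? P))
  ... | yes w = w
  ... | no ¬v = ⊥-elim (Q≢P (⊆-antisym Q⊆P P⊆Q))
    where
    Q⊆P : Q ⊆ₛ P
    Q⊆P {i} i∈Q with i ∈ₛ? P
    ... | yes i∈P = i∈P
    ... | no i∉P  = ⊥-elim (¬v (i , i∈Q , i∉P))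

-- Functions of bounded degree that vanish on injections.

-- On total functions these are the polynomials of degree below `k` in the variables of the pigeons
-- in `P`.
Junta : ℕ → Subset N → Poly N n → Set
Junta k P = Span (λ h → ∃[ Q ] (Q ⊆ₛ P × ∣ Q ∣ < k) × Dep (_∈ₛ Q) h)

Vanishing : Subset N → Poly N n → Set
Vanishing P h = ∀ f → InjOn (_∈ₛ P) f → h f ≡ false

LocalKernel : ℕ → Poly N n → Set
LocalKernel k h = ∃[ Q ] ∣ Q ∣ < k × Dep (_∈ₛ Q) h × Vanishing Q h

Kernel : ℕ → Poly N n → Set
Kernel k = Span (LocalKernel k)

Kernel-suc : ∀ {k} {h : Poly N n} → Kernel k h → Kernel (suc k) h
Kernel-suc = span-mono (λ (Q , lt , rest) → Q , ≤-trans lt (n≤1+n _) , rest)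

Dep-resp : {D : Fin N → Set} {g h : Poly N n} → g ≗ h → Dep D g → Dep D h
Dep-resp e p f g a = ≡-trans (sym (e f)) (≡-trans (p f g a) (e g))

module _ {e : ℕ} {P : Subset N} (bound : 3 * ∣ P ∣ ≤ n) {h : Poly N n} (hV : Vanishing P h)
         (F : Subset N → Poly N n)
         (part : ∀ Q → ((Q ⊆ₛ P × ∣ Q ∣ < suc e) × Dep (_∈ₛ Q) (F Q)) ⊎ (∀ f → F Q f ≡ false))
         (sum : ∀ f → h f ≡ ∑ₛ (λ Q → F Q f)) where

  -- Any other term `F Q′` reads at most `e` pigeons, so it misses one of `Q` and is null on cubes
  -- along `Q`. Thus `h + F Q` is cube-null; as `h` vanishes on injections of `P`, placing the
  -- pigeons of `P` outside `Q` passes this on to `F Q`.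
  top-null : ∀ Q → Q ⊆ₛ P → ∣ Q ∣ ≡ e → Dep (_∈ₛ Q) (F Q) → CubeNull (elements Q) [] (F Q)
  top-null Q Q⊆P Q≡e dep = CubeNull-restrict (elements S) (elements Q) [] {h} unique
    (λ f inj _ → hV f (λ p q → inj (split p) (split q)))
    (CubeNull-resp (elements Q) (λ f → sym (≡-trans (cong (_xor F Q f) (sum f)) (∑ₛ-off Q (λ Q′ → F Q′ f))))
      (CubeNull-span (elements Q) [] (span-∑ₛ (λ Q′ f → off Q (F Q′ f) Q′) others)))
    (Dep-mono (λ p q → disjoint (∈-elements⁺ p) q) dep)
    count
    where
    S = P ─ Q
    disjoint : ∀ {i} → i ∈ elements Q → i ∉ elements S
    disjoint p q = x∈p─q⇒x∉q P Q (∈-elements⁻ S q) (∈-elements⁻ Q p)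
      where
      x∈p─q⇒x∉q : ∀ {N} (p q : Subset N) {x} → x ∈ₛ p ─ q → x ∉ₛ q
      x∈p─q⇒x∉q (_ ∷ p) (false ∷ q) (thereᵥ x∈) (thereᵥ x∈q) = x∈p─q⇒x∉q p q x∈ x∈q
      x∈p─q⇒x∉q (_ ∷ p) (true ∷ q)  (thereᵥ x∈) (thereᵥ x∈q) = x∈p─q⇒x∉q p q x∈ x∈q
    unique : Unique (elements Q ++ elements S)
    unique = Uniqueₚ.++⁺ (elements-unique Q) (elements-unique S) (λ (p , q) → disjoint p q)
    split : ∀ {i} → i ∈ₛ P → i ∈ elements Q ++ elements S
    split {i} i∈P with i ∈ₛ? Q
    ... | yes i∈Q = ∈-++⁺ˡ (∈-elements⁺ i∈Q)
    ... | no i∉Q  = ∈-++⁺ʳ (elements Q) (∈-elements⁺ (x∈p∧x∉q⇒x∈p─q i∈P i∉Q))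
    others : ∀ Q′ → Span (Independent (elements Q)) (λ f → off Q (F Q′ f) Q′)
    others Q′ with Q′ ≟ₛ Q | part Q′
    ... | yes _   | _       = null
    ... | no _    | inj₂ z  = resp (λ f → sym (z f)) null
    ... | no Q′≢Q | inj₁ ((_ , s≤s le) , d) with i , i∈Q , i∉Q′ ← missing Q′≢Q (≤-trans le (≤-reflexive (sym Q≡e)))
        = gen (i , ∈-elements⁺ i∈Q , Dep-mono (λ { p refl → i∉Q′ p }) d)
    -- The factor 3 arises here: two holes per pigeon of `Q` for the cube, one per remaining pigeon,
    -- and both sets are bounded by `P`.
    count : 2 * length (elements Q) + length (elements S) ≤ n
    count = ≤-trans (+-mono-≤ (*-monoʳ-≤ 2 (≤-trans (≤-reflexive (length-elements Q)) (p⊆q⇒∣p∣≤∣q∣ Q⊆P)))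
                              (≤-trans (≤-reflexive (length-elements S)) (∣p─q∣≤∣p∣ P Q)))
                    (≤-trans (≤-reflexive (arith ∣ P ∣)) bound)
      where
      arith : ∀ p → 2 * p + p ≡ 3 * p
      arith p = ≡-trans (+-assoc p (p + 0) p) (cong (λ x → p + x) (≡-trans (+-assoc p 0 p) (cong (p +_) (sym (+-identityʳ p)))))

  -- A term on fewer than `e` pigeons already has low degree. A term on exactly `e` pigeons is
  -- cube-null, so `keyLemma` supplies a lower-degree `w` agreeing with it on injections, and the
  -- difference is the kernel part.
  split-top : ∀ Q → ∃[ κ ] ∃[ w ] Kernel (suc e) κ × Vanishing P κ × Junta e P w × (∀ f → F Q f ≡ κ f xor w f)
  split-top Q with part Q
  ... | inj₂ z = (λ _ → false) , (λ _ → false) , null , (λ _ _ → refl) , null , z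
  ... | inj₁ ((Q⊆P , s≤s le) , dep) with m≤n⇒m<n∨m≡n le
  ...   | inj₁ lt = (λ _ → false) , F Q , null , (λ _ _ → refl) , gen (Q , (Q⊆P , lt) , dep) , λ _ → refl
  ...   | inj₂ Q≡e with w , sw , eq ← keyLemma e (elements Q) [] (F Q)
                                    (≡-trans (length-elements Q) Q≡e) (elements-unique Q)
                                    (≤-trans (*-monoʳ-≤ 2 (≤-trans (≤-reflexive (sym Q≡e)) (p⊆q⇒∣p∣≤∣q∣ Q⊆P)))
                                      (≤-trans (+-monoʳ-≤ ∣ P ∣ (+-monoʳ-≤ ∣ P ∣ z≤n)) bound))
                                    (Dep-mono ∈-elements⁺ dep) (top-null Q Q⊆P Q≡e dep)
          = (λ f → F Q f xor w f) , w ,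
            gen (Q , s≤s le , Dep-xor dep (Dep-mono (∈-elements⁻ Q) (smaller-Dep sw)) , van) ,
            (λ f inj → van f (λ p q → inj (Q⊆P p) (Q⊆P q))) ,
            span-mono shrink sw ,
            (λ f → sym (≡-trans (xor-assoc (F Q f) (w f) (w f)) (≡-trans (cong (F Q f xor_) (xor-same (w f))) (xor-identityʳ _))))
    where
    van : Vanishing Q (λ f → F Q f xor w f)
    van f inj = xor-vanish (eq f (λ p q → inj (∈-elements⁻ Q p) (∈-elements⁻ Q q)) (λ _ ()))
    shrink : ∀ {u} → Smaller (elements Q) u → ∃[ R ] (R ⊆ₛ P × ∣ R ∣ < e) × Dep (_∈ₛ R) u
    shrink (i , i∈Q , d) = Q - i , (Q⊆P ∘ p─q⊆p Q ⁅ i ⁆ , subst (∣ Q - i ∣ <_) Q≡e (x∈p⇒∣p-x∣<∣p∣ (∈-elements⁻ Q i∈Q))) ,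
      Dep-mono (λ (j∈Q , j≢i) → x∈p∧x≢y⇒x∈p-y (∈-elements⁻ Q j∈Q) j≢i) d

-- Induction on the degree bound: `split-top` moves the terms of top degree into the kernel, and the
-- remainder still vanishes on injections of `P` because the kernel parts do.
vanishing-junta : ∀ e {P : Subset N} → 3 * ∣ P ∣ ≤ n → {h : Poly N n} → Junta e P h → Vanishing P h → Kernel e h
vanishing-junta zero bound j v = span-mono (λ { (_ , (_ , ()) , _) }) j
vanishing-junta {N} {n} (suc e) {P} bound {h} j v
  with F , part , sum ← collect (λ Q u → (Q ⊆ₛ P × ∣ Q ∣ < suc e) × Dep (_∈ₛ Q) u)
         (λ (c , p) (_ , q) → c , Dep-xor p q) (λ q (c , p) → c , Dep-resp q p) j
  = resp (λ f → sym (eq f)) (add K (Kernel-suc (vanishing-junta e bound J van)))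
  where
  split = split-top bound v F part sum
  κ w : Poly N n
  κ f = ∑ₛ (λ Q → proj₁ (split Q) f)
  w f = ∑ₛ (λ Q → proj₁ (proj₂ (split Q)) f)
  K : Kernel (suc e) κ
  K = span-∑ₛ (λ Q → proj₁ (split Q)) (λ Q → proj₁ (proj₂ (proj₂ (split Q))))
  J : Junta e P w
  J = span-∑ₛ (λ Q → proj₁ (proj₂ (split Q))) (λ Q → proj₁ (proj₂ (proj₂ (proj₂ (proj₂ (split Q))))))
  eq : ∀ f → h f ≡ κ f xor w f
  eq f = ≡-trans (sum f) (≡-trans (∑ₛ-cong (λ Q → proj₂ (proj₂ (proj₂ (proj₂ (proj₂ (split Q))))) f))
    (∑ₛ-xor (λ Q → proj₁ (split Q) f) (λ Q → proj₁ (proj₂ (split Q)) f)))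
  van : Vanishing P w
  van f inj = ≡-trans (sym (cong (_xor w f) (∑ₛ-zero (λ Q → proj₁ (split Q) f) (λ Q → proj₁ (proj₂ (proj₂ (proj₂ (split Q)))) f inj))))
                      (≡-trans (sym (eq f)) (v f inj))

-- Lowering the index of kernel elements.

restrict : Subset N → Vec (Fin n) N → Vec (Fin n) N → Vec (Fin n) N
restrict P f₀ f = tabulate (λ i → if ⌊ i ∈ₛ? P ⌋ then lookup f i else lookup f₀ i)

restrict-agree : (P : Subset N) (f₀ f g : Vec (Fin n) N) → ∀ i → (i ∈ₛ P → lookup f i ≡ lookup g i) →
                 lookup (restrict P f₀ f) i ≡ lookup (restrict P f₀ g) i
restrict-agree P f₀ f g i e = ≡-trans (lookup∘tabulate _ i) (≡-trans go (sym (lookup∘tabulate _ i)))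
  where
  go : (if ⌊ i ∈ₛ? P ⌋ then lookup f i else lookup f₀ i) ≡ (if ⌊ i ∈ₛ? P ⌋ then lookup g i else lookup f₀ i)
  go with i ∈ₛ? P
  ... | yes p = e p
  ... | no _  = refl

restrict-inside : (P : Subset N) (f₀ f : Vec (Fin n) N) → ∀ i → i ∈ₛ P → lookup (restrict P f₀ f) i ≡ lookup f i
restrict-inside P f₀ f i i∈P = ≡-trans (lookup∘tabulate _ i) (cong (if_then lookup f i else lookup f₀ i) (isYes-true (i ∈ₛ? P) i∈P))

Dep-restrict : (P Q : Subset N) (f₀ : Vec (Fin n) N) {h : Poly N n} → Dep (_∈ₛ Q) h → Dep (_∈ₛ Q ∩ P) (λ f → h (restrict P f₀ f))
Dep-restrict P Q f₀ dep f g e = dep _ _ (λ i i∈Q → restrict-agree P f₀ f g i (λ i∈P → e i (x∈p∩q⁺ (i∈Q , i∈P))))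

-- Fixing all pigeons outside P isolates the part of g on P, up to functions of fewer pigeons.
kernel-descend : ∀ {k} {g : Poly N n} → Vec (Fin n) N → 3 * k ≤ n → Junta k ⊤ g → Kernel (suc k) g → Kernel k g
kernel-descend {N} {n} {k} {g} f₀ bound J K
  with F , part , sum ← collect (λ Q u → ∣ Q ∣ < suc k × Dep (_∈ₛ Q) u × Vanishing Q u)
         (λ (c , p , v) (_ , q , w) → c , Dep-xor p q , λ f i → cong₂ _xor_ (v f i) (w f i))
         (λ q (c , p , v) → c , Dep-resp q p , λ f i → ≡-trans (sym (q f)) (v f i)) K
  = resp (λ f → sym (sum f)) (span-∑ₛ F down)
  where
  down : ∀ P → Kernel k (F P)
  down P with part P
  ... | inj₂ z = resp (λ f → sym (z f)) null
  ... | inj₁ (s≤s le , dep , v) with m≤n⇒m<n∨m≡n le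
  ...   | inj₁ lt   = gen (P , lt , dep , v)
  -- After the restriction, every other summand reads a proper subset of `P`, and `g` is a sum of
  -- functions of fewer than `k` pigeons of `P`. Their total is `F P`, so it has degree below `k`.
  ...   | inj₂ refl = vanishing-junta k bound (resp isolate (add J′ (span-∑ₛ _ others))) v
    where
    ρ = restrict P f₀
    J′ : Junta k P (λ f → g (ρ f))
    J′ = span-map (λ _ → true) ρ (λ { (Q , (_ , lt) , d) →
      gen (Q ∩ P , (p∩q⊆q Q P , ≤-<-trans (∣p∩q∣≤∣p∣ Q P) lt) , Dep-restrict P Q f₀ d) }) J
    others : ∀ Q → Junta k P (λ f → off P (F Q (ρ f)) Q)
    others Q with Q ≟ₛ P | part Q
    ... | yes _  | _      = null
    ... | no _   | inj₂ z = resp (λ f → sym (z _)) null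
    ... | no Q≢P | inj₁ (s≤s le′ , d , _) with i , i∈P , i∉Q ← missing Q≢P le′
        = gen (Q ∩ P , (p∩q⊆q Q P , p⊂q⇒∣p∣<∣q∣
            (p∩q⊆q Q P , i , i∈P , i∉Q ∘ p∩q⊆p Q P)) , Dep-restrict P Q f₀ d)
    isolate : ∀ f → g (ρ f) xor ∑ₛ (λ Q → off P (F Q (ρ f)) Q) ≡ F P f
    isolate f = ≡-trans (cong₂ _xor_ (sum (ρ f)) (sym (∑ₛ-off P (λ Q → F Q (ρ f)))))
                        (≡-trans (xor-cancelˡ (∑ₛ (λ Q → F Q (ρ f))) _) (dep _ _ (restrict-inside P f₀ f)))

-- Linear implication over 𝔽₂.

evalForm-axpy : ∀ {m} (a : Bool) (u v ρ : Vec Bool m) →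
                evalForm (zipWith _xor_ u (vmap (a ∧_) v)) ρ ≡ evalForm u ρ xor (a ∧ evalForm v ρ)
evalForm-axpy a []      []      []      = sym (∧-zeroʳ a)
evalForm-axpy a (x ∷ u) (y ∷ v) (r ∷ ρ) =
  ≡-trans (cong (((x xor (a ∧ y)) ∧ r) xor_) (evalForm-axpy a u v ρ))
          (solve 6 (λ x a y r U V → (x :+ (a :* y)) :* r :+ (U :+ a :* V) := (x :* r :+ U) :+ a :* (y :* r :+ V)) refl
             x a y r (evalForm u ρ) (evalForm v ρ))
  where open xor-∧-Solver

evalForm-zero : ∀ {m} (ρ : Vec Bool m) → evalForm (replicate m false) ρ ≡ false
evalForm-zero []      = refl
evalForm-zero (_ ∷ ρ) = evalForm-zero ρ

Affine : ℕ → Set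
Affine m = Vec Bool m × Bool

affine : ∀ {m} → Affine m → Vec Bool m → Bool
affine (v , c) ρ = evalForm v ρ xor c

AffineSpan : ∀ {m} → List (Affine m) → (Vec Bool m → Bool) → Set
AffineSpan ds = Span (λ h → ∃[ d ] d ∈ ds × affine d ≗ h)

substitute : ∀ {m} → Affine m → Affine (suc m) → Affine m
substitute (v , c) (a ∷ u , b) = zipWith _xor_ u (vmap (a ∧_) v) , b xor (a ∧ c)

substitute-affine : ∀ {m} (s : Affine m) (d : Affine (suc m)) ρ → affine (substitute s d) ρ ≡ affine d (affine s ρ ∷ ρ)
substitute-affine (v , c) (a ∷ u , b) ρ = ≡-trans (cong (_xor (b xor (a ∧ c))) (evalForm-axpy a u v ρ))
  (solve 5 (λ a b c U V → (U :+ a :* V) :+ (b :+ a :* c) := (a :* (V :+ c) :+ U) :+ b) refl a b c (evalForm u ρ) (evalForm v ρ))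
  where open xor-∧-Solver

-- Eliminating the first variable adds a multiple of the pivot, so it stays inside any span that
-- contains the pivot.
substitute-xor : ∀ {m} (s : Affine m) (d : Affine (suc m)) ρ →
                 affine (substitute s d) (tail ρ) ≡ affine d ρ xor (head (proj₁ d) ∧ affine (true ∷ proj₁ s , proj₂ s) ρ)
substitute-xor s d@(a ∷ u , b) (x ∷ ρ) = ≡-trans (substitute-affine s d ρ) (shift-var (affine s ρ) _ refl)
  where
  shift-var : ∀ y z → (x xor evalForm (proj₁ s) ρ) xor proj₂ s ≡ z → affine d (affine s ρ ∷ ρ) ≡ affine d (x ∷ ρ) xor (a ∧ z)
  shift-var y z refl = solve 6 (λ a b x U V c → (a :* (V :+ c) :+ U) :+ b := ((a :* x :+ U) :+ b) :+ a :* ((x :+ V) :+ c)) refl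
                         a b x (evalForm u ρ) (evalForm (proj₁ s) ρ) (proj₂ s)
    where open xor-∧-Solver

-- Gaussian elimination: eliminate the first variable with a pivot if there is one.
affine-nullstellensatz :
  ∀ {m} (ds : List (Affine m)) (e : Affine m) →
  (∀ ρ → (∀ {d} → d ∈ ds → affine d ρ ≡ false) → affine e ρ ≡ false) →
  AffineSpan ds (affine e) ⊎ AffineSpan ds (λ _ → true)
affine-nullstellensatz {zero} ds e H with anyL? (λ d → affine d [] ≟ᵇ true) ds
... | yes p with d , d∈ , t ← find p = inj₂ (gen (d , d∈ , λ { [] → t }))
... | no ¬p = inj₁ (resp (λ { [] → sym (H [] zeros) }) null)
  where
  zeros : ∀ {d} → d ∈ ds → affine d [] ≡ false
  zeros {d} d∈ with affine d [] in eq
  ... | true  = ⊥-elim (¬p (lose d∈ eq))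
  ... | false = refl
affine-nullstellensatz {suc m} ds e H with anyL? (λ d → head (proj₁ d) ≟ᵇ true) ds
... | yes p with (.true ∷ v , c) , d∈ , refl ← find p = [ inj₁ ∘ lift-e , inj₂ ∘ lift ]′ ih
  where
  -- Over 𝔽₂ a zero of the pivot has first coordinate equal to the value of the remaining affine
  -- form, which is what gets substituted.
  s = v , c
  ih = affine-nullstellensatz (map (substitute s) ds) (substitute s e)
         (λ ρ z → ≡-trans (substitute-affine s e ρ)
            (H (affine s ρ ∷ ρ) (λ {d} d∈ → ≡-trans (sym (substitute-affine s d ρ)) (z (∈-map⁺ (substitute s) d∈)))))
  pivot : ∀ a → AffineSpan ds (λ ρ → a ∧ affine (true ∷ v , c) ρ)
  pivot true  = gen (_ , d∈ , λ _ → refl)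
  pivot false = null
  lift : ∀ {h} → AffineSpan (map (substitute s) ds) h → AffineSpan ds (h ∘ tail)
  lift = span-map (λ _ → true) tail onGen
    where
    onGen : ∀ {h} → ∃[ d ] d ∈ map (substitute s) ds × affine d ≗ h → AffineSpan ds (h ∘ tail)
    onGen (_ , d∈ , eq) with d , d∈ds , refl ← ∈-map⁻ (substitute s) d∈ =
      resp (λ ρ → ≡-trans (sym (substitute-xor s d ρ)) (eq (tail ρ)))
           (add (gen (d , d∈ds , λ _ → refl)) (pivot (head (proj₁ d))))
  lift-e : AffineSpan (map (substitute s) ds) (affine (substitute s e)) → AffineSpan ds (affine e)
  lift-e t = resp (λ ρ → ≡-trans (cong (_xor (head (proj₁ e) ∧ affine (true ∷ v , c) ρ)) (substitute-xor s e ρ))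
                           (cancel (affine e ρ) _))
                  (add (lift t) (pivot (head (proj₁ e))))
    where
    cancel : ∀ a b → (a xor b) xor b ≡ a
    cancel a b = ≡-trans (xor-assoc a b b) (≡-trans (cong (a xor_) (xor-same b)) (xor-identityʳ a))
... | no ¬p = drop-e e H
  where
  drop : Affine (suc m) → Affine m
  drop (_ ∷ u , c) = u , c
  drop-affine : ∀ {d} → d ∈ ds → ∀ ρ → affine (drop d) (tail ρ) ≡ affine d ρ
  drop-affine {true ∷ u , c}  d∈ (x ∷ ρ) = ⊥-elim (¬p (lose d∈ refl))
  drop-affine {false ∷ u , c} d∈ (x ∷ ρ) = refl
  lift : ∀ {h} → AffineSpan (map drop ds) h → AffineSpan ds (h ∘ tail)
  lift = span-map (λ _ → true) tail onGen
    where
    onGen : ∀ {h} → ∃[ d ] d ∈ map drop ds × affine d ≗ h → AffineSpan ds (h ∘ tail)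
    onGen (_ , d∈ , eq) with d , d∈ds , refl ← ∈-map⁻ drop d∈ =
      gen (d , d∈ds , λ ρ → ≡-trans (sym (drop-affine d∈ds ρ)) (eq (tail ρ)))
  zeros : ∀ {ρ} x → (∀ {d} → d ∈ map drop ds → affine d ρ ≡ false) → ∀ {d} → d ∈ ds → affine d (x ∷ ρ) ≡ false
  zeros x z d∈ = ≡-trans (sym (drop-affine d∈ (x ∷ _))) (z (∈-map⁺ drop d∈))
  drop-e : ∀ e → (∀ ρ → (∀ {d} → d ∈ ds → affine d ρ ≡ false) → affine e ρ ≡ false) →
           AffineSpan ds (affine e) ⊎ AffineSpan ds (λ _ → true)
  drop-e (false ∷ u , c) H with affine-nullstellensatz (map drop ds) (u , c) (λ ρ z → H (false ∷ ρ) (zeros false z))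
  ... | inj₁ t = inj₁ (resp (λ { (_ ∷ ρ) → refl }) (lift t))
  ... | inj₂ t = inj₂ (lift t)
  -- `e` contains the first variable but no member of `ds` does, so flipping it flips `e` alone.
  -- Hence the system has no solution, and the recursion runs with the constant 1 as target.
  drop-e (true ∷ u , c) H with affine-nullstellensatz (map drop ds) (replicate m false , true)
                                 (λ ρ z → ⊥-elim (clash (evalForm u ρ) c
                                           (H (false ∷ ρ) (zeros false z)) (H (true ∷ ρ) (zeros true z))))
    where
    clash : ∀ a b → a xor b ≡ false → not a xor b ≡ false → Empty
    clash true  true  _  ()
    clash true  false ()
    clash false true  ()
    clash false false _  ()
  ... | inj₁ t = inj₂ (lift (resp (λ ρ → cong (_xor true) (evalForm-zero ρ)) t))
  ... | inj₂ t = inj₂ (lift t)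

-- The complemented constant makes this the indicator of the equation; its zero set is the negated
-- equation.
holds : ∀ {m} → LinEq m → Assignment m → Bool
holds e = affine (form e , not (rhs e))

holds⁺ : ∀ {m} (e : LinEq m) ρ → evalForm (form e) ρ ≡ rhs e → holds e ρ ≡ true
holds⁺ e ρ refl = lemma (evalForm (form e) ρ)
  where
  lemma : ∀ a → a xor not a ≡ true
  lemma true  = refl
  lemma false = refl

holds⁻ : ∀ {m} (e : LinEq m) ρ → holds e ρ ≡ true → evalForm (form e) ρ ≡ rhs e
holds⁻ e ρ = lemma (evalForm (form e) ρ) (rhs e)
  where
  lemma : ∀ a b → a xor not b ≡ true → a ≡ b
  lemma true  true  _ = refl
  lemma false false _ = refl

-- Where all equations of `D` fail, `e` fails too. So the indicators of `D` span either the
-- indicator of `e` or the constant 1, and both are true wherever `e` holds.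
entails-span : ∀ {m} (e : LinEq m) (D : LinClause m) → (∀ ρ → evalForm (form e) ρ ≡ rhs e → Sat ρ D) →
               ∃[ g ] Span (λ h → ∃[ d ] d ∈ D × holds d ≗ h) g × (∀ ρ → holds e ρ ≡ true → g ρ ≡ true)
entails-span {m} e D H = [ (λ s → _ , lower s , λ _ t → t) , (λ s → _ , lower s , λ _ _ → refl) ]′
                     (affine-nullstellensatz (map negated D) (negated e) hyp)
  where
  negated : LinEq m → Affine m
  negated d = form d , not (rhs d)
  hyp : ∀ ρ → (∀ {d} → d ∈ map negated D → affine d ρ ≡ false) → holds e ρ ≡ false
  hyp ρ z with holds e ρ in eq
  ... | false = refl
  ... | true with d , d∈ , t ← find (H ρ (holds⁻ e ρ eq))
      with () ← ≡-trans (sym (holds⁺ d ρ t)) (z (∈-map⁺ negated d∈))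
  lower : ∀ {g} → AffineSpan (map negated D) g → Span (λ h → ∃[ d ] d ∈ D × holds d ≗ h) g
  lower = span-mono onGen
    where
    onGen : ∀ {h} → ∃[ d ] d ∈ map negated D × affine d ≗ h → ∃[ d ] d ∈ D × holds d ≗ h
    onGen (_ , d∈ , eq) with d , d∈D , refl ← ∈-map⁻ negated d∈ = d , d∈D , eq

-- Products of truth values and their degrees.

∣p∪q∣≤∣p∣+∣q∣ : (P Q : Subset N) → ∣ P ∪ Q ∣ ≤ ∣ P ∣ + ∣ Q ∣
∣p∪q∣≤∣p∣+∣q∣ []          []          = z≤n
∣p∪q∣≤∣p∣+∣q∣ (true ∷ P)  (true ∷ Q)  = s≤s (≤-trans (∣p∪q∣≤∣p∣+∣q∣ P Q) (+-monoʳ-≤ ∣ P ∣ (n≤1+n ∣ Q ∣)))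
∣p∪q∣≤∣p∣+∣q∣ (true ∷ P)  (false ∷ Q) = s≤s (∣p∪q∣≤∣p∣+∣q∣ P Q)
∣p∪q∣≤∣p∣+∣q∣ (false ∷ P) (true ∷ Q)  = ≤-trans (s≤s (∣p∪q∣≤∣p∣+∣q∣ P Q)) (≤-reflexive (sym (+-suc ∣ P ∣ ∣ Q ∣)))
∣p∪q∣≤∣p∣+∣q∣ (false ∷ P) (false ∷ Q) = ∣p∪q∣≤∣p∣+∣q∣ P Q

∪-size : ∀ {a} (Q R : Subset N) → ∣ Q ∣ < a → ∣ R ∣ < 2 → ∣ Q ∪ R ∣ < suc a
∪-size Q R Q<a (s≤s R≤1) = s≤s (≤-trans (∣p∪q∣≤∣p∣+∣q∣ Q R)
  (≤-trans (+-monoʳ-≤ ∣ Q ∣ R≤1) (≤-trans (≤-reflexive (+-comm ∣ Q ∣ 1)) Q<a)))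

∪-Dep : (Q R : Subset N) {g h : Poly N n} → Dep (_∈ₛ Q) g → Dep (_∈ₛ R) h → Dep (_∈ₛ Q ∪ R) (λ f → g f ∧ h f)
∪-Dep Q R p q = Dep-∧ (Dep-mono (p⊆p∪q R) p) (Dep-mono (q⊆p∪q Q R) q)

-- Bilinearity: expand one factor over its generators, then the other.
span-product : {X : Set} {G H K : (X → Bool) → Set} → (∀ {g h} → G g → H h → K (λ x → g x ∧ h x)) →
               ∀ {g h} → Span G g → Span H h → Span K (λ x → g x ∧ h x)
span-product f {g} s t = span-map g (λ x → x)
  (λ {h} b → resp (λ x → ∧-comm (h x) (g x))
    (span-map h (λ x → x) (λ {g′} a → resp (λ x → ∧-comm (g′ x) (h x)) (gen (f a b))) s)) t

-- An injection on `Q ∪ R` is one on `Q`, so the product still vanishes; reading one more pigeon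
-- raises the index by one.
kernel-× : ∀ {a} {g h : Poly N n} → Kernel a g → Junta 2 ⊤ h → Kernel (suc a) (λ f → g f ∧ h f)
kernel-× = span-product (λ { {g} {h} (Q , Q<a , p , v) (R , (_ , R<2) , q) →
  Q ∪ R , ∪-size Q R Q<a R<2 , ∪-Dep Q R p q , λ f inj → cong (_∧ h f) (v f (λ x y → inj (p⊆p∪q R x) (p⊆p∪q R y))) })

junta-× : ∀ {a} {g h : Poly N n} → Junta a ⊤ g → Junta 2 ⊤ h → Junta (suc a) ⊤ (λ f → g f ∧ h f)
junta-× = span-product (λ { (Q , (_ , Q<a) , p) (R , (_ , R<2) , q) → Q ∪ R , (⊆⊤ , ∪-size Q R Q<a R<2) , ∪-Dep Q R p q })

junta-suc : ∀ {a} {g : Poly N n} → Junta a ⊤ g → Junta (suc a) ⊤ g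
junta-suc = span-mono (λ { (Q , (s , lt) , p) → Q , (s , ≤-trans lt (n≤1+n _)) , p })

junta-const : ∀ {a} (b : Bool) → Junta {N} {n} (suc a) ⊤ (λ _ → b)
junta-const {N} b = gen (⊥ , (⊆⊤ , s≤s (≤-trans (≤-reflexive (∣⊥∣≡0 N)) z≤n)) , λ _ _ _ → refl)

test : Fin N → Fin n → Poly N n
test i j f = ⌊ lookup f i ≟ j ⌋

junta-test : (i : Fin N) (j : Fin n) → Junta 2 ⊤ (test i j)
junta-test i j = gen (⁅ i ⁆ , (⊆⊤ , s≤s (≤-reflexive (∣⁅x⁆∣≡1 i))) , Dep-mono (λ { refl → x∈⁅x⁆ i }) (Dep-test i j))

junta-form : ∀ {m} (v : LinForm m) (a : Fin m → Poly N n) → (∀ k → Junta 2 ⊤ (a k)) →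
             Junta 2 ⊤ (λ f → evalForm v (tabulate (λ k → a k f)))
junta-form []          a s = null
junta-form (true ∷ v)  a s = add (s zero) (junta-form v (a ∘ suc) (s ∘ suc))
junta-form (false ∷ v) a s = junta-form v (a ∘ suc) (s ∘ suc)

-- The 0/1 matrix of the graph of `f`: pigeon and functionality axioms hold at it, and only hole
-- axioms can fail.
assignment : Vec (Fin n) (suc n) → Assignment (suc n * n)
assignment {n} f = tabulate (λ k → test (proj₁ (remQuot {suc n} n k)) (proj₂ (remQuot {suc n} n k)) f)

evalForm-tabulate : ∀ {m} (A B : Fin m → Bool) → evalForm (tabulate A) (tabulate B) ≡ ∑ (λ k → A k ∧ B k)
evalForm-tabulate {zero}  A B = refl
evalForm-tabulate {suc m} A B = cong ((A zero ∧ B zero) xor_) (evalForm-tabulate (A ∘ suc) (B ∘ suc))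

evalForm-p : (i : Fin (suc n)) (j : Fin n) (f : Vec (Fin n) (suc n)) → evalForm (p i j) (assignment f) ≡ test i j f
evalForm-p {n} i j f = ≡-trans (evalForm-tabulate (λ k → ⌊ combine i j ≟ k ⌋) (λ k → at-cell (remQuot {suc n} n k)))
  (≡-trans (∑-select (combine i j) (λ k → at-cell (remQuot {suc n} n k))) (cong at-cell (remQuot-combine i j)))
  where
  at-cell : Fin (suc n) × Fin n → Bool
  at-cell (i , j) = test i j f

truth : ∀ n → LinEq (suc n * n) → Poly (suc n) n
truth n e f = holds e (assignment f)

-- A parity, however wide, is a sum of functions of one pigeon each, so a linear equation has no
-- higher degree than a literal.
junta-truth : ∀ n → (e : LinEq (suc n * n)) → Junta 2 ⊤ (truth n e)
junta-truth n e = add (junta-form (form e) _ (λ k → junta-test _ _)) (junta-const (not (rhs e)))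

truth-true : (i : Fin (suc n)) (j : Fin n) (f : Vec (Fin n) (suc n)) → truth n (p i j == true) f ≡ test i j f
truth-true {n} i j f = ≡-trans (xor-identityʳ _) (evalForm-p i j f)

truth-false : (i : Fin (suc n)) (j : Fin n) (f : Vec (Fin n) (suc n)) → truth n (p i j == false) f ≡ test i j f xor true
truth-false {n} i j f = cong (_xor true) (evalForm-p i j f)

product : ∀ n → List (LinEq (suc n * n)) → Poly (suc n) n
product n []      f = true
product n (e ∷ Ψ) f = product n Ψ f ∧ truth n e f

junta-product : ∀ n → (Ψ : List (LinEq (suc n * n))) → Junta (suc (length Ψ)) ⊤ (product n Ψ)
junta-product n []      = junta-const true
junta-product n (e ∷ Ψ) = junta-× (junta-product n Ψ) (junta-truth n e)

∧-true : ∀ {a b} → a ∧ b ≡ true → a ≡ true × b ≡ true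
∧-true {true} {true} _ = refl , refl

product-true : ∀ n {Ψ : List (LinEq (suc n * n))} {e : LinEq (suc n * n)} → e ∈ Ψ →
               ∀ f → product n Ψ f ≡ true → truth n e f ≡ true
product-true n {Ψ = e ∷ Ψ} (here refl) f t = proj₂ (∧-true {product n Ψ f} t)
product-true n {Ψ = d ∷ Ψ} (there e∈)  f t = product-true n e∈ f (proj₁ (∧-true {product n Ψ f} t))

∧-absorb : ∀ a b → (a ≡ true → b ≡ true) → a ∧ b ≡ a
∧-absorb true  b h = h refl
∧-absorb false b h = refl

-- Backward propagation along a refutation.

-- Ψ picks one equation from every clause of S.
Refuted : ∀ n → Config (suc n * n) → Set
Refuted n S = ∀ Ψ → Pointwise _∈_ Ψ S → Kernel {suc n} {n} (suc (length Ψ)) (product n Ψ)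

chosen : ∀ {m} {Ψ : List (LinEq m)} {S : Config m} {C : LinClause m} → Pointwise _∈_ Ψ S → C ∈ S → ∃[ e ] e ∈ Ψ × e ∈ C
chosen (e∈ ∷ _)  (here refl) = _ , here refl , e∈
chosen (_ ∷ es) (there C∈) with e , p , q ← chosen es C∈ = e , there p , q

-- Dropping the choice made for the erased clause leaves a choice for the rest, and the product
-- loses one factor.
unchoose : ∀ n {Ψ : List (LinEq (suc n * n))} (S : Config (suc n * n)) → Pointwise _∈_ Ψ S → (i : Fin (length S)) →
           ∃[ e ] ∃[ Ψ′ ] Pointwise _∈_ Ψ′ (removeAt S i) × length Ψ ≡ suc (length Ψ′) ×
           (∀ f → product n Ψ f ≡ product n Ψ′ f ∧ truth n e f)
unchoose n {e ∷ Ψ} (C ∷ S) (e∈ ∷ es) zero = e , Ψ , es , refl , λ _ → refl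
unchoose n {Ψ = d ∷ Ψ} (C ∷ S) (d∈ ∷ es) (suc i) with e , Ψ′ , es′ , len , eq ← unchoose n S es i
  = e , d ∷ Ψ′ , d∈ ∷ es′ , cong suc len , λ f →
    ≡-trans (cong (_∧ truth n d f) (eq f)) (≡-trans (∧-assoc (product n Ψ′ f) _ _)
      (≡-trans (cong (product n Ψ′ f ∧_) (∧-comm (truth n e f) (truth n d f))) (sym (∧-assoc (product n Ψ′ f) _ _))))

module _ {n} (f₀ : Vec (Fin n) (suc n)) where

  -- Every point sends pigeon `i` to exactly one hole, so `g` is the sum of its products with the
  -- tests of `i`. These lie in the kernel one index too high, which the descent repairs.
  refute-pigeon : ∀ {k} (i : Fin (suc n)) {g : Poly (suc n) n} → 3 * suc k ≤ n → Junta (suc k) ⊤ g →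
                  (∀ e → e ∈ pigeonClause i → Kernel (suc (suc k)) (λ f → g f ∧ truth n e f)) → Kernel (suc k) g
  refute-pigeon i {g} bound J H = kernel-descend f₀ bound J
    (resp (λ f → ∑-select (lookup f i) (λ _ → g f))
      (span-∑ _ (λ j → resp (λ f → ≡-trans (cong (g f ∧_) (truth-true i j f)) (∧-comm (g f) _))
                            (H (p i j == true) (∈-map⁺ (λ j → p i j == true) (∈-allFin j))))))

  -- With `x` and `y` the two tests, `g = g (x + 1) y + g (y + 1) + x y g`. The first two terms come
  -- from the two choices in the clause, the last from the violated axiom. The extra factor `y`
  -- costs another index, hence two descents.
  refute-conflict : ∀ {k} (i i′ : Fin (suc n)) (j j′ : Fin n) {g : Poly (suc n) n} →
                    3 * suc (suc k) ≤ n → Junta (suc k) ⊤ g →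
                    Kernel (suc (suc (suc k))) (λ f → (test i j f ∧ test i′ j′ f) ∧ g f) →
                    (∀ e → e ∈ (p i j == false) ∷ (p i′ j′ == false) ∷ [] → Kernel (suc (suc k)) (λ f → g f ∧ truth n e f)) →
                    Kernel (suc k) g
  refute-conflict {k = k} i i′ j j′ {g} bound J C H =
    kernel-descend f₀ (≤-trans (*-monoʳ-≤ 3 (n≤1+n (suc k))) bound) J (kernel-descend f₀ bound (junta-suc J)
      (resp (λ f → ≡-trans
               (cong₂ (λ a b → (((g f ∧ a) ∧ test i′ j′ f) xor (g f ∧ b)) xor ((test i j f ∧ test i′ j′ f) ∧ g f))
                      (truth-false i j f) (truth-false i′ j′ f))
               (solve 3 (λ g x y → ((g :* (x :+ con true) :* y) :+ (g :* (y :+ con true))) :+ (x :* y) :* g := g) refl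
                      (g f) (test i j f) (test i′ j′ f)))
        (add (add (kernel-× (H _ (here refl)) (junta-test i′ j′)) (Kernel-suc (H _ (there (here refl))))) C)))
    where open xor-∧-Solver

  kernel-product : ∀ {k} {h : Poly (suc n) n} (Ψ : List (LinEq (suc n * n))) → Kernel k h →
                   Kernel (length Ψ + k) (λ f → h f ∧ product n Ψ f)
  kernel-product         []      K = resp (λ f → ∧-comm true _) K
  kernel-product {h = h} (e ∷ Ψ) K = resp (λ f → ∧-assoc (h f) _ _) (kernel-× (kernel-product Ψ K) (junta-truth n e))

  hole-kernel : (i i′ : Fin (suc n)) (j : Fin n) → i ≢ i′ → Kernel 3 (λ f → test i j f ∧ test i′ j f)
  hole-kernel i i′ j i≢i′ = gen (⁅ i ⁆ ∪ ⁅ i′ ⁆ ,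
      s≤s (≤-trans (∣p∪q∣≤∣p∣+∣q∣ ⁅ i ⁆ ⁅ i′ ⁆) (≤-reflexive (cong₂ _+_ (∣⁅x⁆∣≡1 i) (∣⁅x⁆∣≡1 i′)))) ,
      ∪-Dep ⁅ i ⁆ ⁅ i′ ⁆ (Dep-mono (λ { refl → x∈⁅x⁆ i }) (Dep-test i j))
                         (Dep-mono (λ { refl → x∈⁅x⁆ i′ }) (Dep-test i′ j)) ,
      λ f inj → van f (i≢i′ ∘ inj (p⊆p∪q ⁅ i′ ⁆ (x∈⁅x⁆ i)) (q⊆p∪q ⁅ i ⁆ ⁅ i′ ⁆ (x∈⁅x⁆ i′))))
    where
    van : ∀ f → lookup f i ≢ lookup f i′ → test i j f ∧ test i′ j f ≡ false
    van f ne with lookup f i ≟ j | lookup f i′ ≟ j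
    ... | no _     | _      = refl
    ... | yes _    | no _   = refl
    ... | yes refl | yes eq = ⊥-elim (ne (sym eq))

  func-null : (i : Fin (suc n)) (j j′ : Fin n) → j ≢ j′ → ∀ f → test i j f ∧ test i j′ f ≡ false
  func-null i j j′ j≢j′ f with lookup f i ≟ j | lookup f i ≟ j′
  ... | no _     | _        = refl
  ... | yes _    | no _     = refl
  ... | yes refl | yes refl = ⊥-elim (j≢j′ refl)

  -- When a clause is added, the extended choices give products of index one higher; the old product
  -- is recovered from them and then descends. Erasure only multiplies by one more factor.
  refuted-step : ∀ {s} → 6 * s < n → {S S′ : Config (suc n * n)} → Step (FPHP n) S S′ →
                 length S′ ≤ s → Refuted n S′ → Refuted n S
  refuted-step {s} 6s<n {S} st S′≤s R Ψ es = back st S′≤s R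
    where
    k = length Ψ
    -- This fixes the constant 6: `Ψ` has one equation per clause of `S`, and `3 (length S + 2) ≤ 6
    -- (length S + 1) ≤ 6 s < n`.
    bound : suc (length S) ≤ s → 3 * suc (suc k) ≤ n
    bound le = ≤-trans (*-monoʳ-≤ 3 (s≤s (s≤s (≤-trans (≤-reflexive (Pointwise-length es)) (m≤m+n _ _)))))
                 (≤-trans (≤-reflexive (arith (length S)))
                   (≤-trans (*-monoʳ-≤ 6 le) (≤-trans (n≤1+n _) 6s<n)))
      where
      arith : ∀ l → 3 * suc (suc (l + l)) ≡ 6 * suc l
      arith = solve 1 (λ l → con 3 :* (con 2 :+ (l :+ l)) := con 6 :* (con 1 :+ l)) refl
        where open +-*-Solver
    bound₁ : suc (length S) ≤ s → 3 * suc k ≤ n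
    bound₁ le = ≤-trans (*-monoʳ-≤ 3 (n≤1+n (suc k))) (bound le)
    J = junta-product n Ψ
    descend : suc (length S) ≤ s → Kernel (suc (suc k)) (product n Ψ) → Kernel (suc k) (product n Ψ)
    descend le = kernel-descend f₀ (bound₁ le) J
    widen : ∀ {h} → Kernel 3 h → Kernel (suc (suc (suc k))) (λ f → h f ∧ product n Ψ f)
    widen {h} K = subst (λ a → Kernel {suc n} {n} a (λ f → h f ∧ product n Ψ f)) (+-comm k 3) (kernel-product Ψ K)
    back : ∀ {S′} → Step (FPHP n) S S′ → length S′ ≤ s → Refuted n S′ → Kernel (suc k) (product n Ψ)
    back (axiom _ (pigeon i)) le R = refute-pigeon i (bound₁ le) J (λ e e∈ → R (e ∷ Ψ) (e∈ ∷ es))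
    back (axiom _ (hole i i′ j i≢i′)) le R = refute-conflict i i′ j j (bound le) J
      (widen (hole-kernel i i′ j i≢i′)) (λ e e∈ → R (e ∷ Ψ) (e∈ ∷ es))
    back (axiom _ (func i j j′ j≢j′)) le R = refute-conflict i i j j′ (bound le) J
      (widen (resp (λ f → sym (func-null i j j′ j≢j′ f)) null)) (λ e e∈ → R (e ∷ Ψ) (e∈ ∷ es))
    back (erase i) le R with e , Ψ′ , es′ , len , eq ← unchoose n S es i
      = resp (λ f → sym (eq f))
          (subst (λ a → Kernel {suc n} {n} (suc a) (λ f → product n Ψ′ f ∧ truth n e f)) (sym len)
                 (kernel-× (R Ψ′ es′) (junta-truth n e)))
    back (resolve C₁ C₂ h A B C₁∈ C₂∈ p₁ p₂) le R
      with e₁ , e₁∈Ψ , e₁∈ ← chosen es C₁∈ | e₂ , e₂∈Ψ , e₂∈ ← chosen es C₂∈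
      with ∈-resp-↭ p₁ e₁∈ | ∈-resp-↭ p₂ e₂∈
    -- An equation of `Ψ` that survives in the resolvent is chosen a second time, and repeating a
    -- factor does not change the product.
    ... | there e₁∈A | _ =
      descend le (resp (λ f → ∧-absorb (product n Ψ f) _ (product-true n e₁∈Ψ f)) (R (e₁ ∷ Ψ) (∈-++⁺ˡ e₁∈A ∷ es)))
    ... | here _ | there e₂∈B =
      descend le (resp (λ f → ∧-absorb (product n Ψ f) _ (product-true n e₂∈Ψ f)) (R (e₂ ∷ Ψ) (∈-++⁺ʳ A e₂∈B ∷ es)))
    -- Both choices are the resolved equations, which never hold together, so the product is zero.
    ... | here refl | here refl = resp clash null
      where
      clash : ∀ f → false ≡ product n Ψ f
      clash f with product n Ψ f in eq
      ... | false = refl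
      ... | true with () ← ≡-trans (sym (holds⁻ (h == false) (assignment f) (product-true n e₁∈Ψ f eq)))
                                   (holds⁻ (h == true) (assignment f) (product-true n e₂∈Ψ f eq))
    back (weaken C D C∈ C⊨D) le R with e , e∈Ψ , e∈C ← chosen es C∈
      with g , span , e⇒g ← entails-span e D (λ ρ t → C⊨D ρ (lose e∈C t))
      -- The sum `g` is true wherever `e` is, so multiplying by it keeps the product; expanding `g`
      -- leaves products with choices from `D`.
      = descend le (resp (λ f → ∧-absorb (product n Ψ f) _ (λ t → e⇒g _ (product-true n e∈Ψ f t)))
          (span-map (product n Ψ) assignment (λ { (d , d∈ , eq) →
            resp (λ f → cong (product n Ψ f ∧_) (eq _)) (R (d ∷ Ψ) (d∈ ∷ es)) }) span))

  refuted-start : ∀ {s} → 6 * s < n → {S : Config (suc n * n)} → Reach (FPHP n) s S → Refuted n S → Refuted n []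
  refuted-start lt start           R = R
  refuted-start lt (step r st len) R = refuted-start lt r (refuted-step lt st len R)

-- A set of fewer than one pigeon is empty, and every point is injective on it.
kernel-one-null : {g : Poly N n} → Kernel 1 g → ∀ f → g f ≡ false
kernel-one-null (gen (Q , s≤s Q≤0 , _ , v)) f = v f (λ i∈Q → ⊥-elim (n≮0 (≤-trans (x∈p⇒∣p-x∣<∣p∣ i∈Q) Q≤0)))
kernel-one-null null       f = refl
kernel-one-null (add s t)  f = cong₂ _xor_ (kernel-one-null s f) (kernel-one-null t f)
kernel-one-null (resp e s) f = ≡-trans (sym (e f)) (kernel-one-null s f)

theorem4p14 : ∃[ c ] ∃[ n₀ ] ∀ (n : ℕ) → n₀ ≤ n → ∀ (s : ℕ) → RefutableInSpace (FPHP n) s → n ≤ c * s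
theorem4p14 = 6 , 0 , λ n _ s → bound n s
  where
  -- The descent needs some placement of all pigeons, which exists once there is a hole.
  f₀ : Vec (Fin (suc n)) (suc (suc n))
  f₀ = replicate _ zero
  no-choice : {S : Config (suc n * n)} → [] ∈ S → Refuted n S
  -- The empty clause offers no equation, so the invariant starts out vacuously true.
  no-choice []∈S Ψ es with _ , _ , () ← chosen es []∈S
  bound : ∀ n s → RefutableInSpace (FPHP n) s → n ≤ 6 * s
  bound zero    s _ = z≤n
  bound (suc n) s (S , r , []∈S) with suc n ≤? 6 * s
  ... | yes le = le
  -- The empty choice has product 1, which cannot lie in `Kernel 1`.
  ... | no ¬le with () ← kernel-one-null (refuted-start f₀ (≰⇒> ¬le) r (no-choice []∈S) [] []) f₀
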